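{- Let $(G_n)_{n\ge 0}$ be the sequence of graphs with special vertices $X_n,Y_n$ defined in the context, let $T_n(x,y)=T(G_n;x,y)$ be the Tutte polynomial of $G_n$, and let $T_{1,n}(x,y)$, $T_{2,n}(x,y)$ be the partial sums defined in the context. Then for every $n\ge 0$ the Tutte polynomial of $G_{n+1}$ is given by $$T_{n+1}(x,y)=T_{1,n+1}(x,y)+T_{2,n+1}(x,y),$$ where the polynomials $T_{1,n+1}$ and $T_{2,n+1}$ satisfy the following recursive relations (as identities of rational functions in $x,y$, with $T_{i,n}=T_{i,n}(x,y)$): $$T_{1,n+1}(x,y)=y(y-1)\,T_{1,n}^4+\frac{4y}{x-1}\,T_{1,n}^{3}T_{2,n}+\frac{2x+2}{(x-1)^{2}}\,T_{1,n}^{2}T_{2,n}^2,$$ $$T_{2,n+1}(x,y)=\frac{2y+2}{x-1}\,T_{1,n}^{2}T_{2,n}^2+\frac{4x}{(x-1)^{2}}\,T_{1,n}T_{2,n}^{3}+\frac{x}{(x-1)^{2}}\,T_{2,n}^4,$$ with initial conditions $T_{1,0}(x,y)=1$ and $T_{2,0}(x,y)=x-1$.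
   Context: Tutte polynomial: for a graph $G$ with vertex set $V(G)$, edge set $E(G)$ and $k(G)$ connected components, put $r(G)=|V(G)|-k(G)$ and $n(G)=|E(G)|-|V(G)|+k(G)$. Then $T(G;x,y)=\sum_{H\subseteq G}(x-1)^{r(G)-r(H)}(y-1)^{n(H)}$, where the sum runs over all spanning subgraphs $H$ of $G$ (subgraphs with $V(H)=V(G)$ and arbitrary $E(H)\subseteq E(G)$). The graphs $G_n$: $G_0$ is the complete graph $K_2$ with its two vertices denoted $X_0,Y_0$. For $n\ge 0$, given $G_n$ with two special vertices $X_n,Y_n$, take four disjoint copies $G_n^1,G_n^2,G_n^3,G_n^4$ of $G_n$, with special vertices $X_n^i,Y_n^i$. Identify $X_n^1$ with $X_n^2$ to form the special vertex $X_{n+1}$ of $G_{n+1}$; identify $Y_n^3$ with $Y_n^4$ to form the special vertex $Y_{n+1}$ of $G_{n+1}$; identify $Y_n^1$ with $X_n^3$ to form a vertex $a$, and $Y_n^2$ with $X_n^4$ to form a vertex $b$; finally add a new edge $e_n$ joining $a$ and $b$. The result is $G_{n+1}$. Partial sums: let $\mathcal{G}_{1,n}$ be the set of spanning subgraphs $H$ of $G_n$ in which $X_n$ and $Y_n$ belong to the same connected component of $H$, and $\mathcal{G}_{2,n}$ the set of spanning subgraphs in which $X_n$ and $Y_n$ do not belong to the same component. For $i=1,2$, $T_{i,n}(x,y)=\sum_{H\in\mathcal{G}_{i,n}}(x-1)^{r(G_n)-r(H)}(y-1)^{n(H)}$. -}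

module Defs where

open import Algebra.Bundles using (CommutativeRing)
open import Algebra.Structures using (IsCommutativeRing)
open import Data.Fin.Base as Fin using (Fin; combine)
open import Data.Fin.Patterns using (0F; 1F; 2F; 3F)
import Data.Fin.Properties as Fin
import Data.Integer.Base as ℤ
import Data.Integer.Properties as ℤ
open import Data.List.Base
  using (List; []; _∷_; _++_; map; concatMap; foldr; filter; length; allFin; deduplicate)
open import Data.List.Membership.Propositional using (_∈_)
open import Data.List.Relation.Unary.Any using (here; there)
open import Data.Nat.Base as ℕ using (ℕ; zero; suc; _∸_)
open import Data.Product.Base as Product using (_×_; _,_)
open import Data.Sum.Base using (_⊎_; inj₁; inj₂; [_,_]′)
open import Level using (_⊔_)
open import Relation.Binary.Construct.Closure.Equivalence as EqC using (EqClosure)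
open import Relation.Binary.Construct.Closure.ReflexiveTransitive using (ε; _◅_; _◅◅_)
open import Relation.Binary.Construct.Closure.Symmetric using (fwd; bwd)
open import Relation.Binary.Definitions using (Decidable)
open import Relation.Binary.PropositionalEquality.Core as ≡ using (_≡_)
open import Relation.Nullary using (¬_; Dec; yes; no; ¬?; contradiction)
open import Relation.Nullary.Decidable using (map′; _×-dec_; _⊎-dec_)

private
  variable
    v : ℕ

-- A graph with vertex set Fin v, given by the list of its edges. The order of
-- the two endpoints in a pair is irrelevant, see Connected. A repeated pair
-- would count as parallel edges; the graphs G below have none.

Graph : ℕ → Set
Graph v = List (Fin v × Fin v)

∣V∣ : Graph v → ℕ
∣V∣ {v} _ = v

∣E∣ : Graph v → ℕ
∣E∣ = length

Connected : Graph v → Fin v → Fin v → Set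
Connected G = EqClosure (λ s t → (s , t) ∈ G)

module _ {s t : Fin v} {G : Graph v} where

  private
    C : Fin v → Fin v → Set
    C = Connected G

    _⟷_ : Fin v → Fin v → Set
    u ⟷ w = C u w ⊎ (C u s × C t w ⊎ C u t × C s w)

    step : ∀ {u u′ w} → C u u′ → u′ ⟷ w → u ⟷ w
    step p (inj₁ q)              = inj₁ (p ◅◅ q)
    step p (inj₂ (inj₁ (q , r))) = inj₂ (inj₁ (p ◅◅ q , r))
    step p (inj₂ (inj₂ (q , r))) = inj₂ (inj₂ (p ◅◅ q , r))

    across : ∀ {w} → t ⟷ w → s ⟷ w
    across (inj₁ q)              = inj₂ (inj₁ (ε , q))
    across (inj₂ (inj₁ (_ , r))) = inj₂ (inj₁ (ε , r))
    across (inj₂ (inj₂ (_ , r))) = inj₁ r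

    across⁻¹ : ∀ {w} → s ⟷ w → t ⟷ w
    across⁻¹ (inj₁ q)              = inj₂ (inj₂ (ε , q))
    across⁻¹ (inj₂ (inj₁ (_ , r))) = inj₁ r
    across⁻¹ (inj₂ (inj₂ (_ , r))) = inj₂ (inj₂ (ε , r))

  connected-∷⁻ : ∀ {u w} → Connected ((s , t) ∷ G) u w →
                 C u w ⊎ (C u s × C t w ⊎ C u t × C s w)
  connected-∷⁻ ε                          = inj₁ ε
  connected-∷⁻ (fwd (here ≡.refl) ◅ p) = across (connected-∷⁻ p)
  connected-∷⁻ (bwd (here ≡.refl) ◅ p) = across⁻¹ (connected-∷⁻ p)
  connected-∷⁻ (fwd (there e) ◅ p)     = step (fwd e ◅ ε) (connected-∷⁻ p)
  connected-∷⁻ (bwd (there e) ◅ p)     = step (bwd e ◅ ε) (connected-∷⁻ p)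

  connected-∷⁺ : ∀ {u w} → C u w ⊎ (C u s × C t w ⊎ C u t × C s w) →
                 Connected ((s , t) ∷ G) u w
  connected-∷⁺ (inj₁ p)              = EqC.map there p
  connected-∷⁺ (inj₂ (inj₁ (p , q))) =
    EqC.map there p ◅◅ fwd (here ≡.refl) ◅ EqC.map there q
  connected-∷⁺ (inj₂ (inj₂ (p , q))) =
    EqC.map there p ◅◅ bwd (here ≡.refl) ◅ EqC.map there q

connected? : (G : Graph v) → Decidable (Connected G)
connected? []            u w = map′ (λ { ≡.refl → ε }) (λ { ε → ≡.refl
                                                         ; (fwd () ◅ _)
                                                         ; (bwd () ◅ _) }) (u Fin.≟ w)
connected? ((s , t) ∷ G) u w = map′ connected-∷⁺ connected-∷⁻
  (connected? G u w ⊎-dec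
  ((connected? G u s ×-dec connected? G t w) ⊎-dec
   (connected? G u t ×-dec connected? G s w)))

-- The number of connected components: keep one vertex from each component.

k : Graph v → ℕ
k {v} G = length (deduplicate (connected? G) (allFin v))

r : Graph v → ℕ
r G = ∣V∣ G ∸ k G

-- Adding before subtracting keeps the truncated subtraction exact: every
-- edge lowers the number of components by at most one.

n : Graph v → ℕ
n G = (∣E∣ G ℕ.+ k G) ∸ ∣V∣ G

-- All sublists of the edge list, each edge being either kept or deleted.

spanningSubgraphs : Graph v → List (Graph v)
spanningSubgraphs []      = [] ∷ []
spanningSubgraphs (e ∷ G) = map (e ∷_) (spanningSubgraphs G) ++ spanningSubgraphs G

-- The number of non-special vertices of G_m. Those of G_{m+1} are a, b and the
-- ones of the four copies of G_m.

inner : ℕ → ℕ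
inner zero    = 0
inner (suc m) = 2 ℕ.+ 4 ℕ.* inner m

order : ℕ → ℕ
order m = 2 ℕ.+ inner m

X Y : ∀ m → Fin (order m)
X _ = 0F
Y _ = 1F

a b : ∀ m → Fin (order (suc m))
a _ = 2F
b _ = 3F

-- The image in G_{m+1} of a vertex of the i-th copy of G_m. The copies are
-- numbered 0, 1, 2, 3, and only their special vertices get identified.

glue : ∀ m → Fin 4 → Fin (order m) → Fin (order (suc m))
glue m 0F 0F = X (suc m)
glue m 1F 0F = X (suc m)
glue m 2F 0F = a m
glue m 3F 0F = b m
glue m 0F 1F = a m
glue m 1F 1F = b m
glue m 2F 1F = Y (suc m)
glue m 3F 1F = Y (suc m)
glue m i (Fin.suc (Fin.suc u)) =
  Fin.suc (Fin.suc (Fin.suc (Fin.suc (combine i u))))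

copy : ∀ m → Fin 4 → Graph (order m) → Graph (order (suc m))
copy m i = map (Product.map (glue m i) (glue m i))

G : ∀ m → Graph (order m)
G zero    = (X 0 , Y 0) ∷ []
G (suc m) = (a m , b m) ∷ concatMap (λ i → copy m i (G m)) (allFin 4)

-- T(G;x,y) for elements x, y of a commutative ring; the polynomial itself is
-- obtained at the two indeterminates of ℤ[x,y].

module Tutte {c ℓ} (R : CommutativeRing c ℓ) (x y : CommutativeRing.Carrier R) where

  open CommutativeRing R
  open import Algebra.Properties.Semiring.Exp semiring using (_^_)

  -- r G ∸ r H is exact for a spanning subgraph H of G, since then r H ≤ r G.

  term : Graph v → Graph v → Carrier
  term G H = (x - 1#) ^ (r G ∸ r H) * (y - 1#) ^ n H

  ∑[_]_ : List (Graph v) → (Graph v → Carrier) → Carrier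
  ∑[ Hs ] f = foldr _+_ 0# (map f Hs)

  tutte : Graph v → Carrier
  tutte G = ∑[ spanningSubgraphs G ] term G

  tutteConnected : Graph v → Fin v → Fin v → Carrier
  tutteConnected G s t =
    ∑[ filter (λ H → connected? H s t) (spanningSubgraphs G) ] term G

  tutteDisconnected : Graph v → Fin v → Fin v → Carrier
  tutteDisconnected G s t =
    ∑[ filter (λ H → ¬? (connected? H s t)) (spanningSubgraphs G) ] term G

record IsDiscreteDomain {c ℓ} (R : CommutativeRing c ℓ) : Set (c ⊔ ℓ) where
  open CommutativeRing R
  field
    1≉0            : 1# ≉ 0#
    zero?          : ∀ p → Dec (p ≈ 0#)
    noZeroDivisors : ∀ {p q} → p ≉ 0# → p * q ≈ 0# → q ≈ 0#

  *-≉0 : ∀ {p q} → p ≉ 0# → q ≉ 0# → p * q ≉ 0#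
  *-≉0 p≉0 q≉0 pq≈0 = q≉0 (noZeroDivisors p≉0 pq≈0)

  *-cancelˡ : ∀ {p q s} → p ≉ 0# → p * q ≈ p * s → q ≈ s
  *-cancelˡ {p} {q} {s} p≉0 pq≈ps = x∙y⁻¹≈ε⇒x≈y q s (noZeroDivisors p≉0 (begin
    p * (q - s)        ≈⟨ distribˡ p q (- s) ⟩
    p * q + p * - s    ≈⟨ +-congˡ (-‿distribʳ-* p s) ⟨
    p * q + - (p * s)  ≈⟨ +-congʳ pq≈ps ⟩
    p * s + - (p * s)  ≈⟨ -‿inverseʳ (p * s) ⟩
    0#                 ∎))
    where
    open import Relation.Binary.Reasoning.Setoid setoid
    open import Algebra.Properties.Group +-group using (x∙y⁻¹≈ε⇒x≈y)
    open import Algebra.Properties.Ring ring using (-‿distribʳ-*)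

module Polynomial {c ℓ} (R : CommutativeRing c ℓ) where

  open CommutativeRing R hiding (isCommutativeRing)
  open import Algebra.Properties.Ring ring using (-0#≈0#)

  -- Coefficients, constant one first; trailing zeros are allowed.

  Poly : Set c
  Poly = List Carrier

  coeff : Poly → ℕ → Carrier
  coeff []      _       = 0#
  coeff (α ∷ p) zero    = α
  coeff (α ∷ p) (suc i) = coeff p i

  infix 4 _≋_
  record _≋_ (p q : Poly) : Set ℓ where
    constructor coeffwise
    field
      at : ∀ i → coeff p i ≈ coeff q i
  open _≋_ public

  infixl 6 _⊞_
  infixl 7 _·_ _⊠_

  _⊞_ : Poly → Poly → Poly
  []      ⊞ q       = q
  (α ∷ p) ⊞ []      = α ∷ p
  (α ∷ p) ⊞ (β ∷ q) = (α + β) ∷ (p ⊞ q)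

  _·_ : Carrier → Poly → Poly
  α · p = map (α *_) p

  _⊠_ : Poly → Poly → Poly
  []      ⊠ q = []
  (α ∷ p) ⊠ q = α · q ⊞ (0# ∷ p ⊠ q)

  ⊟_ : Poly → Poly
  ⊟ p = map -_ p

  const : Carrier → Poly
  const α = α ∷ []

  indeterminate : Poly
  indeterminate = 0# ∷ 1# ∷ []

  private
    coeff-⊞ : ∀ p q i → coeff (p ⊞ q) i ≈ coeff p i + coeff q i
    coeff-⊞ []      q       i       = sym (+-identityˡ _)
    coeff-⊞ (α ∷ p) []      i       = sym (+-identityʳ _)
    coeff-⊞ (α ∷ p) (β ∷ q) zero    = refl
    coeff-⊞ (α ∷ p) (β ∷ q) (suc i) = coeff-⊞ p q i

    coeff-· : ∀ α p i → coeff (α · p) i ≈ α * coeff p i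
    coeff-· α []      i       = sym (zeroʳ α)
    coeff-· α (β ∷ p) zero    = refl
    coeff-· α (β ∷ p) (suc i) = coeff-· α p i

    coeff-⊟ : ∀ p i → coeff (⊟ p) i ≈ - coeff p i
    coeff-⊟ []      i       = sym -0#≈0#
    coeff-⊟ (α ∷ p) zero    = refl
    coeff-⊟ (α ∷ p) (suc i) = coeff-⊟ p i

    ≋-refl : ∀ {p} → p ≋ p
    ≋-refl .at i = refl

    ≋-sym : ∀ {p q} → p ≋ q → q ≋ p
    ≋-sym e .at i = sym (e .at i)

    ≋-trans : ∀ {p q s} → p ≋ q → q ≋ s → p ≋ s
    ≋-trans e f .at i = trans (e .at i) (f .at i)

    ⊞-cong : ∀ {p p′ q q′} → p ≋ p′ → q ≋ q′ → p ⊞ q ≋ p′ ⊞ q′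
    ⊞-cong {p} {p′} {q} {q′} e f .at i =
      trans (coeff-⊞ p q i) (trans (+-cong (e .at i) (f .at i)) (sym (coeff-⊞ p′ q′ i)))

    ⊞-assoc : ∀ p q s → (p ⊞ q) ⊞ s ≋ p ⊞ (q ⊞ s)
    ⊞-assoc p q s .at i =
      trans (coeff-⊞ (p ⊞ q) s i)
      (trans (+-congʳ (coeff-⊞ p q i))
      (trans (+-assoc _ _ _)
      (trans (+-congˡ (sym (coeff-⊞ q s i)))
             (sym (coeff-⊞ p (q ⊞ s) i)))))

    ⊞-comm : ∀ p q → p ⊞ q ≋ q ⊞ p
    ⊞-comm p q .at i =
      trans (coeff-⊞ p q i) (trans (+-comm _ _) (sym (coeff-⊞ q p i)))

    ⊞-identityʳ : ∀ p → p ⊞ [] ≋ p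
    ⊞-identityʳ p = ⊞-comm p []

    ⊟-cong : ∀ {p q} → p ≋ q → ⊟ p ≋ ⊟ q
    ⊟-cong {p} {q} e .at i =
      trans (coeff-⊟ p i) (trans (-‿cong (e .at i)) (sym (coeff-⊟ q i)))

    ⊟-inverseʳ : ∀ p → p ⊞ ⊟ p ≋ []
    ⊟-inverseʳ p .at i =
      trans (coeff-⊞ p (⊟ p) i) (trans (+-congˡ (coeff-⊟ p i)) (-‿inverseʳ _))

    open import Algebra.Bundles using (CommutativeMonoid)

    ⊞-commutativeMonoid : CommutativeMonoid c ℓ
    ⊞-commutativeMonoid = record
      { isCommutativeMonoid = record
        { isMonoid = record
          { isSemigroup = record
            { isMagma = record
              { isEquivalence = record { refl = ≋-refl ; sym = ≋-sym ; trans = ≋-trans }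
              ; ∙-cong        = ⊞-cong
              }
            ; assoc = ⊞-assoc
            }
          ; identity = (λ _ → ≋-refl) , ⊞-identityʳ
          }
        ; comm = ⊞-comm
        }
      }

    open import Algebra.Properties.CommutativeSemigroup
      (CommutativeMonoid.commutativeSemigroup ⊞-commutativeMonoid)
      using (interchange; x∙yz≈y∙xz)
    open import Relation.Binary.Reasoning.Setoid
      (CommutativeMonoid.setoid ⊞-commutativeMonoid)

    ∷-cong : ∀ {α β p q} → α ≈ β → p ≋ q → α ∷ p ≋ β ∷ q
    ∷-cong e f .at zero    = e
    ∷-cong e f .at (suc i) = f .at i

    0∷[] : 0# ∷ [] ≋ []
    0∷[] .at zero    = refl
    0∷[] .at (suc i) = refl

    tail : ∀ {α β p q} → α ∷ p ≋ β ∷ q → p ≋ q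
    tail e .at i = e .at (suc i)

    tail-[] : ∀ {α p} → α ∷ p ≋ [] → p ≋ []
    tail-[] e .at i = e .at (suc i)

    0∷-⊞ : ∀ p q → 0# ∷ (p ⊞ q) ≋ (0# ∷ p) ⊞ (0# ∷ q)
    0∷-⊞ p q = ∷-cong (sym (+-identityˡ 0#)) ≋-refl

    ·-cong : ∀ {α β p q} → α ≈ β → p ≋ q → α · p ≋ β · q
    ·-cong {α} {β} {p} {q} e f .at i =
      trans (coeff-· α p i) (trans (*-cong e (f .at i)) (sym (coeff-· β q i)))

    ·-zeroˡ : ∀ p → 0# · p ≋ []
    ·-zeroˡ p .at i = trans (coeff-· 0# p i) (zeroˡ _)

    ·-identityˡ : ∀ p → 1# · p ≋ p
    ·-identityˡ p .at i = trans (coeff-· 1# p i) (*-identityˡ _)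

    ·-assoc : ∀ α β p → (α * β) · p ≋ α · (β · p)
    ·-assoc α β p .at i =
      trans (coeff-· (α * β) p i)
      (trans (*-assoc _ _ _)
      (trans (*-congˡ (sym (coeff-· β p i)))
             (sym (coeff-· α (β · p) i))))

    ·-distribʳ : ∀ α β p → (α + β) · p ≋ α · p ⊞ β · p
    ·-distribʳ α β p .at i =
      trans (coeff-· (α + β) p i)
      (trans (distribʳ _ _ _)
      (trans (+-cong (sym (coeff-· α p i)) (sym (coeff-· β p i)))
             (sym (coeff-⊞ (α · p) (β · p) i))))

    ·-distribˡ : ∀ α p q → α · (p ⊞ q) ≋ α · p ⊞ α · q
    ·-distribˡ α p q .at i =
      trans (coeff-· α (p ⊞ q) i)
      (trans (*-congˡ (coeff-⊞ p q i))
      (trans (distribˡ _ _ _)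
      (trans (+-cong (sym (coeff-· α p i)) (sym (coeff-· α q i)))
             (sym (coeff-⊞ (α · p) (α · q) i)))))

    ⊠-zero : ∀ {p} q → p ≋ [] → p ⊠ q ≋ []
    ⊠-zero {[]}    q e = ≋-refl
    ⊠-zero {α ∷ p} q e = begin
      α · q ⊞ (0# ∷ p ⊠ q)  ≈⟨ ⊞-cong (·-cong (e .at 0) ≋-refl)
                                      (∷-cong refl (⊠-zero q (tail-[] e))) ⟩
      0# · q ⊞ (0# ∷ [])    ≈⟨ ⊞-cong (·-zeroˡ q) 0∷[] ⟩
      []                    ∎

    ⊠-congʳ : ∀ {p p′} q → p ≋ p′ → p ⊠ q ≋ p′ ⊠ q
    ⊠-congʳ {[]}             q e = ≋-sym (⊠-zero q (≋-sym e))
    ⊠-congʳ {α ∷ p} {[]}     q e = ⊠-zero q e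
    ⊠-congʳ {α ∷ p} {β ∷ p′} q e =
      ⊞-cong (·-cong (e .at 0) ≋-refl) (∷-cong refl (⊠-congʳ q (tail e)))

    ⊠-[] : ∀ p → p ⊠ [] ≋ []
    ⊠-[] []      = ≋-refl
    ⊠-[] (α ∷ p) = ≋-trans (∷-cong refl (⊠-[] p)) 0∷[]

    ⊠-∷ : ∀ p β q → p ⊠ (β ∷ q) ≋ β · p ⊞ (0# ∷ p ⊠ q)
    ⊠-∷ []      β q = ≋-sym 0∷[]
    ⊠-∷ (α ∷ p) β q = ∷-cong (+-congʳ (*-comm α β)) (begin
      α · q ⊞ p ⊠ (β ∷ q)             ≈⟨ ⊞-cong ≋-refl (⊠-∷ p β q) ⟩
      α · q ⊞ (β · p ⊞ (0# ∷ p ⊠ q))  ≈⟨ x∙yz≈y∙xz (α · q) (β · p) _ ⟩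
      β · p ⊞ (α · q ⊞ (0# ∷ p ⊠ q))  ∎)

    ⊠-comm : ∀ p q → p ⊠ q ≋ q ⊠ p
    ⊠-comm []      q = ≋-sym (⊠-[] q)
    ⊠-comm (α ∷ p) q = begin
      α · q ⊞ (0# ∷ p ⊠ q)  ≈⟨ ⊞-cong ≋-refl (∷-cong refl (⊠-comm p q)) ⟩
      α · q ⊞ (0# ∷ q ⊠ p)  ≈⟨ ⊠-∷ q α p ⟨
      q ⊠ (α ∷ p)           ∎

    ⊠-cong : ∀ {p p′ q q′} → p ≋ p′ → q ≋ q′ → p ⊠ q ≋ p′ ⊠ q′
    ⊠-cong {p} {p′} {q} {q′} e f = begin
      p ⊠ q    ≈⟨ ⊠-congʳ q e ⟩
      p′ ⊠ q   ≈⟨ ⊠-comm p′ q ⟩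
      q ⊠ p′   ≈⟨ ⊠-congʳ p′ f ⟩
      q′ ⊠ p′  ≈⟨ ⊠-comm q′ p′ ⟩
      p′ ⊠ q′  ∎

    ⊠-distribʳ : ∀ q p p′ → (p ⊞ p′) ⊠ q ≋ p ⊠ q ⊞ p′ ⊠ q
    ⊠-distribʳ q []      p′       = ≋-refl
    ⊠-distribʳ q (α ∷ p) []       = ≋-sym (⊞-identityʳ _)
    ⊠-distribʳ q (α ∷ p) (β ∷ p′) = begin
      (α + β) · q ⊞ (0# ∷ (p ⊞ p′) ⊠ q)
        ≈⟨ ⊞-cong (·-distribʳ α β q)
                  (≋-trans (∷-cong refl (⊠-distribʳ q p p′)) (0∷-⊞ (p ⊠ q) (p′ ⊠ q))) ⟩
      (α · q ⊞ β · q) ⊞ ((0# ∷ p ⊠ q) ⊞ (0# ∷ p′ ⊠ q))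
        ≈⟨ interchange (α · q) (β · q) _ _ ⟩
      (α · q ⊞ (0# ∷ p ⊠ q)) ⊞ (β · q ⊞ (0# ∷ p′ ⊠ q)) ∎

    ⊠-distribˡ : ∀ q p p′ → q ⊠ (p ⊞ p′) ≋ q ⊠ p ⊞ q ⊠ p′
    ⊠-distribˡ q p p′ = begin
      q ⊠ (p ⊞ p′)    ≈⟨ ⊠-comm q (p ⊞ p′) ⟩
      (p ⊞ p′) ⊠ q    ≈⟨ ⊠-distribʳ q p p′ ⟩
      p ⊠ q ⊞ p′ ⊠ q  ≈⟨ ⊞-cong (⊠-comm p q) (⊠-comm p′ q) ⟩
      q ⊠ p ⊞ q ⊠ p′  ∎

    0∷-⊠ : ∀ p q → (0# ∷ p) ⊠ q ≋ 0# ∷ p ⊠ q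
    0∷-⊠ p q = ⊞-cong (·-zeroˡ q) ≋-refl

    ·-⊠ : ∀ α p q → (α · p) ⊠ q ≋ α · (p ⊠ q)
    ·-⊠ α []      q = ≋-refl
    ·-⊠ α (β ∷ p) q = begin
      (α * β) · q ⊞ (0# ∷ (α · p) ⊠ q)
        ≈⟨ ⊞-cong (·-assoc α β q) (∷-cong (sym (zeroʳ α)) (·-⊠ α p q)) ⟩
      α · (β · q) ⊞ α · (0# ∷ p ⊠ q)
        ≈⟨ ·-distribˡ α (β · q) (0# ∷ p ⊠ q) ⟨
      α · (β · q ⊞ (0# ∷ p ⊠ q)) ∎

    ⊠-assoc : ∀ p q s → (p ⊠ q) ⊠ s ≋ p ⊠ (q ⊠ s)
    ⊠-assoc []      q s = ≋-refl
    ⊠-assoc (α ∷ p) q s = begin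
      (α · q ⊞ (0# ∷ p ⊠ q)) ⊠ s        ≈⟨ ⊠-distribʳ s (α · q) (0# ∷ p ⊠ q) ⟩
      (α · q) ⊠ s ⊞ (0# ∷ p ⊠ q) ⊠ s    ≈⟨ ⊞-cong (·-⊠ α q s) (0∷-⊠ (p ⊠ q) s) ⟩
      α · (q ⊠ s) ⊞ (0# ∷ (p ⊠ q) ⊠ s)  ≈⟨ ⊞-cong ≋-refl (∷-cong refl (⊠-assoc p q s)) ⟩
      α · (q ⊠ s) ⊞ (0# ∷ p ⊠ (q ⊠ s))  ∎

    ⊠-identityˡ : ∀ p → const 1# ⊠ p ≋ p
    ⊠-identityˡ p = begin
      1# · p ⊞ (0# ∷ [])  ≈⟨ ⊞-cong (·-identityˡ p) 0∷[] ⟩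
      p ⊞ []              ≈⟨ ⊞-identityʳ p ⟩
      p                   ∎

  abstract
    isCommutativeRing : IsCommutativeRing _≋_ _⊞_ _⊠_ ⊟_ [] (const 1#)
    isCommutativeRing = record
      { isRing = record
        { +-isAbelianGroup = record
          { isGroup = record
            { isMonoid = CommutativeMonoid.isMonoid ⊞-commutativeMonoid
            ; inverse  = (λ p → ≋-trans (⊞-comm (⊟ p) p) (⊟-inverseʳ p)) , ⊟-inverseʳ
            ; ⁻¹-cong  = ⊟-cong
            }
          ; comm = ⊞-comm
          }
        ; *-cong     = ⊠-cong
        ; *-assoc    = ⊠-assoc
        ; *-identity = ⊠-identityˡ , (λ p → ≋-trans (⊠-comm p (const 1#)) (⊠-identityˡ p))
        ; distrib    = ⊠-distribˡ , ⊠-distribʳ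
        }
      ; *-comm = ⊠-comm
      }

  commutativeRing : CommutativeRing c ℓ
  commutativeRing = record { isCommutativeRing = isCommutativeRing }

  module _ (dom : IsDiscreteDomain R) where

    private
      module D = IsDiscreteDomain dom

      zero? : ∀ p → Dec (p ≋ [])
      zero? []      = yes ≋-refl
      zero? (α ∷ p) = map′
        (λ (e , f) → ≋-trans (∷-cong e f) 0∷[])
        (λ e → e .at 0 , tail-[] e)
        (D.zero? α ×-dec zero? p)

      α≉0⇒q≋[] : ∀ {α} p q → α ≉ 0# → (α ∷ p) ⊠ q ≋ [] → q ≋ []
      α≉0⇒q≋[] p []      α≉0 e = ≋-refl
      α≉0⇒q≋[] {α} p (β ∷ q) α≉0 e = begin
        β ∷ q    ≈⟨ ∷-cong β≈0 (α≉0⇒q≋[] p q α≉0 rest) ⟩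
        0# ∷ []  ≈⟨ 0∷[] ⟩
        []       ∎
        where
        β≈0 : β ≈ 0#
        β≈0 = D.noZeroDivisors α≉0 (trans (sym (+-identityʳ (α * β))) (e .at 0))

        rest : (α ∷ p) ⊠ q ≋ []
        rest = tail-[] (begin
          0# ∷ (α ∷ p) ⊠ q
            ≈⟨ ⊞-cong (≋-trans (·-cong β≈0 ≋-refl) (·-zeroˡ (α ∷ p))) ≋-refl ⟨
          β · (α ∷ p) ⊞ (0# ∷ (α ∷ p) ⊠ q)
            ≈⟨ ⊠-∷ (α ∷ p) β q ⟨
          (α ∷ p) ⊠ (β ∷ q)
            ≈⟨ e ⟩
          [] ∎)

      noZeroDivisors : ∀ p q → ¬ p ≋ [] → p ⊠ q ≋ [] → q ≋ []
      noZeroDivisors []      q p≉0 e = contradiction ≋-refl p≉0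
      noZeroDivisors (α ∷ p) q p≉0 e with D.zero? α
      ... | no  α≉0 = α≉0⇒q≋[] p q α≉0 e
      ... | yes α≈0 = noZeroDivisors p q
        (λ p≈0 → p≉0 (≋-trans (∷-cong α≈0 p≈0) 0∷[]))
        (tail-[] (begin
          0# ∷ p ⊠ q    ≈⟨ 0∷-⊠ p q ⟨
          (0# ∷ p) ⊠ q  ≈⟨ ⊠-congʳ {α ∷ p} {0# ∷ p} q (∷-cong α≈0 ≋-refl) ⟨
          (α ∷ p) ⊠ q   ≈⟨ e ⟩
          []            ∎))

    isDiscreteDomain : IsDiscreteDomain commutativeRing
    isDiscreteDomain = record
      { 1≉0            = λ e → D.1≉0 (e .at 0)
      ; zero?          = zero?
      ; noZeroDivisors = λ {p} {q} → noZeroDivisors p q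
      }

module Fractions {c ℓ} (R : CommutativeRing c ℓ) (dom : IsDiscreteDomain R) where

  open CommutativeRing R hiding (isCommutativeRing)
  open IsDiscreteDomain dom
  open import Algebra.Properties.Ring ring using (-‿distribˡ-*)
  open import Algebra.Solver.Ring.NaturalCoefficients.Default commutativeSemiring
    using (solve; _:=_; _:+_; _:*_)
  open import Relation.Binary.Reasoning.Setoid setoid

  record Fraction : Set (c ⊔ ℓ) where
    constructor fraction
    field
      numerator     : Carrier
      denominator   : Carrier
      denominator≉0 : denominator ≉ 0#
  open Fraction public

  private
    ↥ ↧ : Fraction → Carrier
    ↥ = numerator
    ↧ = denominator

  infix 4 _≃_
  record _≃_ (f g : Fraction) : Set ℓ where
    constructor cross
    field
      crossMultiplied : ↥ f * ↧ g ≈ ↥ g * ↧ f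
  open _≃_ public

  infixl 6 _⊕_
  infixl 7 _⊗_

  _⊕_ : Fraction → Fraction → Fraction
  fraction p q q≉0 ⊕ fraction s t t≉0 =
    fraction (p * t + s * q) (q * t) (*-≉0 q≉0 t≉0)

  _⊗_ : Fraction → Fraction → Fraction
  fraction p q q≉0 ⊗ fraction s t t≉0 = fraction (p * s) (q * t) (*-≉0 q≉0 t≉0)

  ⊖_ : Fraction → Fraction
  ⊖ fraction p q q≉0 = fraction (- p) q q≉0

  ι : Carrier → Fraction
  ι p = fraction p 1# 1≉0

  private
    ≃-trans : ∀ {f g h} → f ≃ g → g ≃ h → f ≃ h
    ≃-trans {fraction p q _} {fraction s t t≉0} {fraction u w _} (cross e) (cross e′) =
      cross (*-cancelˡ t≉0 (begin
        t * (p * w)  ≈⟨ solve 3 (λ t p w → t :* (p :* w) := (p :* t) :* w) refl t p w ⟩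
        (p * t) * w  ≈⟨ *-congʳ e ⟩
        (s * q) * w  ≈⟨ solve 3 (λ s q w → (s :* q) :* w := (s :* w) :* q) refl s q w ⟩
        (s * w) * q  ≈⟨ *-congʳ e′ ⟩
        (u * t) * q  ≈⟨ solve 3 (λ u t q → (u :* t) :* q := t :* (u :* q)) refl u t q ⟩
        t * (u * q)  ∎))

    ⊕-cong : ∀ {f f′ g g′} → f ≃ f′ → g ≃ g′ → f ⊕ g ≃ f′ ⊕ g′
    ⊕-cong {fraction p q _} {fraction p′ q′ _} {fraction s t _} {fraction s′ t′ _}
      (cross e) (cross e′) = cross (begin
        (p * t + s * q) * (q′ * t′)
          ≈⟨ solve 6 (λ p q s t q′ t′ → (p :* t :+ s :* q) :* (q′ :* t′) :=
                       (p :* q′) :* (t :* t′) :+ (s :* t′) :* (q :* q′))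
                     refl p q s t q′ t′ ⟩
        (p * q′) * (t * t′) + (s * t′) * (q * q′)
          ≈⟨ +-cong (*-congʳ e) (*-congʳ e′) ⟩
        (p′ * q) * (t * t′) + (s′ * t) * (q * q′)
          ≈⟨ solve 6 (λ p′ q s′ t q′ t′ →
                       (p′ :* q) :* (t :* t′) :+ (s′ :* t) :* (q :* q′) :=
                       (p′ :* t′ :+ s′ :* q′) :* (q :* t))
                     refl p′ q s′ t q′ t′ ⟩
        (p′ * t′ + s′ * q′) * (q * t) ∎)

    ⊗-cong : ∀ {f f′ g g′} → f ≃ f′ → g ≃ g′ → f ⊗ g ≃ f′ ⊗ g′
    ⊗-cong {fraction p q _} {fraction p′ q′ _} {fraction s t _} {fraction s′ t′ _}
      (cross e) (cross e′) = cross (begin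
        (p * s) * (q′ * t′)  ≈⟨ solve 4 (λ p s q′ t′ → (p :* s) :* (q′ :* t′) :=
                                          (p :* q′) :* (s :* t′)) refl p s q′ t′ ⟩
        (p * q′) * (s * t′)  ≈⟨ *-cong e e′ ⟩
        (p′ * q) * (s′ * t)  ≈⟨ solve 4 (λ p′ s′ q t → (p′ :* q) :* (s′ :* t) :=
                                          (p′ :* s′) :* (q :* t)) refl p′ s′ q t ⟩
        (p′ * s′) * (q * t)  ∎)

    ⊖-cong : ∀ {f g} → f ≃ g → ⊖ f ≃ ⊖ g
    ⊖-cong {fraction p q _} {fraction s t _} (cross e) = cross (begin
      - p * t    ≈⟨ -‿distribˡ-* p t ⟨
      - (p * t)  ≈⟨ -‿cong e ⟩
      - (s * q)  ≈⟨ -‿distribˡ-* s q ⟩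
      - s * q    ∎)

    ⊕-assoc : ∀ f g h → (f ⊕ g) ⊕ h ≃ f ⊕ (g ⊕ h)
    ⊕-assoc (fraction p q _) (fraction s t _) (fraction u w _) = cross
      (solve 6 (λ p q s t u w →
         ((p :* t :+ s :* q) :* w :+ u :* (q :* t)) :* (q :* (t :* w)) :=
         (p :* (t :* w) :+ (s :* w :+ u :* t) :* q) :* ((q :* t) :* w))
       refl p q s t u w)

    ⊕-comm : ∀ f g → f ⊕ g ≃ g ⊕ f
    ⊕-comm (fraction p q _) (fraction s t _) = cross
      (solve 4 (λ p q s t → (p :* t :+ s :* q) :* (t :* q) :=
                            (s :* q :+ p :* t) :* (q :* t)) refl p q s t)

    ⊕-identityˡ : ∀ f → ι 0# ⊕ f ≃ f
    ⊕-identityˡ (fraction p q _) = cross (begin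
      (0# * q + p * 1#) * q  ≈⟨ *-congʳ (+-cong (zeroˡ q) (*-identityʳ p)) ⟩
      (0# + p) * q           ≈⟨ *-cong (+-identityˡ p) (sym (*-identityˡ q)) ⟩
      p * (1# * q)           ∎)

    ⊖-inverseˡ : ∀ f → ⊖ f ⊕ f ≃ ι 0#
    ⊖-inverseˡ (fraction p q _) = cross (begin
      (- p * q + p * q) * 1#  ≈⟨ *-identityʳ _ ⟩
      - p * q + p * q         ≈⟨ distribʳ q (- p) p ⟨
      (- p + p) * q           ≈⟨ *-congʳ (-‿inverseˡ p) ⟩
      0# * q                  ≈⟨ zeroˡ q ⟩
      0#                      ≈⟨ zeroˡ (q * q) ⟨
      0# * (q * q)            ∎)

    ⊗-assoc : ∀ f g h → (f ⊗ g) ⊗ h ≃ f ⊗ (g ⊗ h)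
    ⊗-assoc (fraction p q _) (fraction s t _) (fraction u w _) = cross
      (solve 6 (λ p q s t u w → ((p :* s) :* u) :* (q :* (t :* w)) :=
                                (p :* (s :* u)) :* ((q :* t) :* w)) refl p q s t u w)

    ⊗-comm : ∀ f g → f ⊗ g ≃ g ⊗ f
    ⊗-comm (fraction p q _) (fraction s t _) = cross
      (solve 4 (λ p q s t → (p :* s) :* (t :* q) := (s :* p) :* (q :* t)) refl p q s t)

    ⊗-identityˡ : ∀ f → ι 1# ⊗ f ≃ f
    ⊗-identityˡ (fraction p q _) =
      cross (*-cong (*-identityˡ p) (sym (*-identityˡ q)))

    ⊗-distribʳ : ∀ f g h → (g ⊕ h) ⊗ f ≃ (g ⊗ f) ⊕ (h ⊗ f)
    ⊗-distribʳ (fraction p q _) (fraction s t _) (fraction u w _) = cross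
      (solve 6 (λ p q s t u w →
         ((s :* w :+ u :* t) :* p) :* ((t :* q) :* (w :* q)) :=
         ((s :* p) :* (w :* q) :+ (u :* p) :* (t :* q)) :* ((t :* w) :* q))
       refl p q s t u w)

  abstract
    isCommutativeRing : IsCommutativeRing _≃_ _⊕_ _⊗_ ⊖_ (ι 0#) (ι 1#)
    isCommutativeRing = record
      { isRing = record
        { +-isAbelianGroup = record
          { isGroup = record
            { isMonoid = record
              { isSemigroup = record
                { isMagma = record
                  { isEquivalence = record
                    { refl  = cross refl
                    ; sym   = λ (cross e) → cross (sym e)
                    ; trans = ≃-trans
                    }
                  ; ∙-cong = ⊕-cong
                  }
                ; assoc = ⊕-assoc
                }
              ; identity = ⊕-identityˡ , λ f → ≃-trans (⊕-comm f (ι 0#)) (⊕-identityˡ f)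
              }
            ; inverse = ⊖-inverseˡ , λ f → ≃-trans (⊕-comm f (⊖ f)) (⊖-inverseˡ f)
            ; ⁻¹-cong = ⊖-cong
            }
          ; comm = ⊕-comm
          }
        ; *-cong     = ⊗-cong
        ; *-assoc    = ⊗-assoc
        ; *-identity = ⊗-identityˡ , λ f → ≃-trans (⊗-comm f (ι 1#)) (⊗-identityˡ f)
        ; distrib    = (λ f g h → ≃-trans (⊗-comm f (g ⊕ h))
                                  (≃-trans (⊗-distribʳ f g h)
                                           (⊕-cong (⊗-comm g f) (⊗-comm h f))))
                     , ⊗-distribʳ
        }
      ; *-comm = ⊗-comm
      }

  commutativeRing : CommutativeRing (c ⊔ ℓ) ℓ
  commutativeRing = record { isCommutativeRing = isCommutativeRing }

ℤ-isDiscreteDomain : IsDiscreteDomain ℤ.+-*-commutativeRing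
ℤ-isDiscreteDomain = record
  { 1≉0            = λ ()
  ; zero?          = ℤ._≟ ℤ.0ℤ
  ; noZeroDivisors = λ {p} {q} p≢0 pq≡0 →
      [ (λ p≡0 → contradiction p≡0 p≢0) , (λ q≡0 → q≡0) ]′ (ℤ.i*j≡0⇒i≡0∨j≡0 p pq≡0)
  }

module ℤ[x]    = Polynomial ℤ.+-*-commutativeRing
module ℤ[x][y] = Polynomial ℤ[x].commutativeRing

ℤ[x,y] : CommutativeRing _ _
ℤ[x,y] = ℤ[x][y].commutativeRing

ℤ[x,y]-isDiscreteDomain : IsDiscreteDomain ℤ[x,y]
ℤ[x,y]-isDiscreteDomain =
  ℤ[x][y].isDiscreteDomain (ℤ[x].isDiscreteDomain ℤ-isDiscreteDomain)

module ℤxy = CommutativeRing ℤ[x,y]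
open ℤxy public using (Carrier; _≈_; _≉_; _+_; _*_; _-_; 0#; 1#)
open import Algebra.Properties.Semiring.Exp ℤxy.semiring public using (_^_)
open import Algebra.Properties.Semiring.Mult ℤxy.semiring public renaming (_×_ to _·_) using ()

x y : Carrier
x = ℤ[x][y].const ℤ[x].indeterminate
y = ℤ[x][y].indeterminate

module ℤ⟨x,y⟩ = Fractions ℤ[x,y] ℤ[x,y]-isDiscreteDomain
open ℤ⟨x,y⟩ public using (Fraction; fraction; ι)

ℤ⟨x,y⟩-commutativeRing : CommutativeRing _ _
ℤ⟨x,y⟩-commutativeRing = ℤ⟨x,y⟩.commutativeRing

module F = CommutativeRing ℤ⟨x,y⟩-commutativeRing
open F public using () renaming (_≈_ to _≈ᶠ_; _+_ to _+ᶠ_; _*_ to _*ᶠ_)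
open import Algebra.Properties.Semiring.Exp F.semiring public using () renaming (_^_ to _^ᶠ_)

[x-1]^_≉0 : ∀ i → (x - 1#) ^ i ≉ 0#
[x-1]^ zero  ≉0 = IsDiscreteDomain.1≉0 ℤ[x,y]-isDiscreteDomain
[x-1]^ suc i ≉0 = IsDiscreteDomain.*-≉0 ℤ[x,y]-isDiscreteDomain
  {x - 1#} {(x - 1#) ^ i} x-1≉0 ([x-1]^ i ≉0)
  where
  x-1≉0 : x - 1# ≉ 0#
  x-1≉0 e with () ← e .ℤ[x][y].at 0 .ℤ[x].at 0

infixl 7 _/[x-1]^_
_/[x-1]^_ : Carrier → ℕ → Fraction
p /[x-1]^ i = fraction p ((x - 1#) ^ i) ([x-1]^ i ≉0)

T T₁ T₂ : ℕ → Carrier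
T  m = Tutte.tutte             ℤ[x,y] x y (G m)
T₁ m = Tutte.tutteConnected    ℤ[x,y] x y (G m) (X m) (Y m)
T₂ m = Tutte.tutteDisconnected ℤ[x,y] x y (G m) (X m) (Y m)

{-# OPTIONS --safe #-}

module Submission where

-- A spanning subgraph H of G_{m+1} consists of four spanning subgraphs of G_m
-- and possibly the edge ab. Contracting each of the four to an edge or to
-- nothing, according to whether it joins its special vertices, leaves a graph
-- S on X, Y, a, b (and isolated vertices). Since a copy meets the rest of H
-- only in two vertices, X, Y, a, b are connected in H as in S, the nullity of H
-- is the sum of the nullities of the four pieces and of S, and so is its rank
-- after adding the number c of edges contributed by the copies. Hence the term
-- of H is the product of the four terms times
-- (x-1)^-(1 + rank S - c) (y-1)^nullity S, and summing over the 32 possible S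
-- gives the recursion.

open import Algebra.Bundles using (CommutativeRing)
open import Algebra.Morphism.Structures using (module RingMorphisms)
open import Defs
  hiding (Carrier; x; y; _≈_; _≉_; _+_; _*_; _-_; 0#; 1#; _^_; _·_; ι; Fraction; fraction;
          _≈ᶠ_; _+ᶠ_; _*ᶠ_; _^ᶠ_)
open import Data.Bool.Base using (Bool; true; false; not; _∧_; _∨_; if_then_else_)
open import Data.Fin.Base as Fin using (Fin)
open import Data.List.Base
  using (List; []; _∷_; _++_; map; length; filter; allFin; deduplicate; concatMap)
open import Data.Nat.Base as ℕ using (ℕ; zero; suc; _∸_)
open import Data.Product.Base as Product using (_×_; _,_)
open import Data.Vec.Base as Vec using (Vec; []; _∷_)
open import Function.Base using (_∘_; id)
open import Level using (Level)
open import Relation.Binary.PropositionalEquality as ≡ using (_≡_)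
open import Relation.Nullary using (¬_; Dec; does; ¬?)
open import Relation.Unary using (Pred; Decidable)

-- The correction c arises because replacing a linked copy by an edge counts the connection between
-- its special vertices twice: once in the rank of the copy and once through the edge. The summand 1
-- arises because four copies of `G m` have total rank 4 + 4 `inner m`, one more than the rank 3 + 4
-- `inner m` of `G (suc m)`. The powers of `x - 1` in the weights are negative, so the recursion
-- cannot be derived inside ℤ[x,y]. It is proved in any commutative ring in which `x - 1` has an
-- inverse `d`, applied to a ring of fractions, and compared with the images of the polynomials
-- under `ι`. ℤ[x,y] itself enters only at the end. Subtraction in `r`, `n` and the exponents is
-- truncated. Hence all identities for ranks, lengths and coranks are stated additively, with c or
-- the excess added to one side, and are cancelled afterwards.

private
  variable
    ℓ : Level
    v w l : ℕ

module Graphs where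

  open import Data.Fin.Base using (_↑ʳ_; combine)
  open import Data.Fin.Patterns using (0F; 1F; 2F; 3F)
  open import Data.Fin.Properties using (combine-injective; ↑ʳ-injective)
  open import Data.List.Membership.Propositional using (_∈_)
  open import Data.List.Membership.Propositional.Properties
    using (∈-map⁺; ∈-map⁻; ∈-++⁺ˡ; ∈-++⁺ʳ; ∈-++⁻; ∈-allFin)
  open import Data.List.Properties
    using (length-map; length-++; map-++; ++-assoc; ++-identityʳ; length-tabulate; filter-all)
  open import Data.List.Relation.Binary.Permutation.Propositional using (_↭_; ↭-sym)
  open import Data.List.Relation.Binary.Permutation.Propositional.Properties
    using (∈-resp-↭; ++-comm; shifts; ↭-length)
  open import Data.List.Relation.Binary.Subset.Propositional using (_⊆_)
  open import Data.List.Relation.Unary.All as All using (All; []; _∷_)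
  open import Data.List.Relation.Unary.AllPairs.Core using (AllPairs; []; _∷_)
  open import Data.List.Relation.Unary.Any as Any using (Any; here; there; any?)
  import Data.List.Relation.Unary.Any.Properties as Any
  import Data.List.Relation.Unary.Unique.DecSetoid.Properties as Unique
  open import Data.List.Relation.Unary.Unique.Propositional using (Unique)
  open import Data.List.Relation.Unary.Unique.Propositional.Properties using (allFin⁺)
  open import Data.Nat.Base using (_+_; _≤_; s≤s; z≤n)
  open import Data.Nat.Properties as ℕ using (+-suc; +-comm; +-assoc; _≤?_)
  open import Data.Nat.Solver using (module +-*-Solver)
  open import Data.Product.Base using (∃; proj₁; proj₂)
  open import Data.Sum.Base using (_⊎_; inj₁; inj₂; [_,_]′)
  open import Function.Bundles using (_⇔_; mk⇔; Equivalence)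
  open import Function.Definitions using (Injective)
  open import Relation.Binary.Construct.Closure.Equivalence as EqC using ()
  open import Relation.Binary.Construct.Closure.ReflexiveTransitive using (ε; _◅_; _◅◅_)
  open import Relation.Binary.Construct.Closure.Symmetric using (SymClosure; fwd; bwd)
  open import Relation.Binary.Core using (Rel)
  open import Relation.Binary.PropositionalEquality
    using (_≢_; refl; sym; trans; cong; cong₂; subst; module ≡-Reasoning)
  open import Relation.Binary.Structures using (IsDecEquivalence)
  open import Relation.Nullary using (yes; no; contradiction)
  open import Relation.Nullary.Decidable
    using (does-⇔; dec-true; dec-false; map′; from-yes; _⊎-dec_; _×-dec_)

  -- Counting the equivalence classes met by a list

  indicator : Bool → ℕ
  indicator true  = 1
  indicator false = 0

  module Classes {A : Set} {R : Rel A ℓ} (E : IsDecEquivalence R) where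

    open IsDecEquivalence E public using (_≟_)
      renaming (refl to R-refl; sym to R-sym; trans to R-trans)

    classes : List A → ℕ
    classes xs = length (deduplicate _≟_ xs)

    meets? : ∀ x xs → Dec (Any (R x) xs)
    meets? x = any? (x ≟_)

    private
      -- Two entries related to `x` would be related to each other, so the filter drops one entry or
      -- none.
      length-remove : ∀ x {ys} → AllPairs (λ y z → ¬ R y z) ys →
        indicator (does (meets? x ys)) + length (filter (¬? ∘ (x ≟_)) ys) ≡ length ys
      length-remove x [] = refl
      length-remove x {y ∷ ys} (y≁ys ∷ ys!) with x ≟ y
      ... | no  _   = trans (+-suc _ _) (cong suc (length-remove x ys!))
      ... | yes xRy = cong (suc ∘ length)
        (filter-all (¬? ∘ (x ≟_)) (All.map (λ ¬yRz xRz → ¬yRz (R-trans (R-sym xRy) xRz)) y≁ys))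

      meets-deduplicate : ∀ x xs → does (meets? x (deduplicate _≟_ xs)) ≡ does (meets? x xs)
      meets-deduplicate x xs = does-⇔
        (mk⇔ (Any.deduplicate⁻ _≟_) (Any.deduplicate⁺ _≟_ (λ zRy xRy → R-trans xRy (R-sym zRy))))
        (meets? x (deduplicate _≟_ xs)) (meets? x xs)

    classes-∷ : ∀ x xs → classes (x ∷ xs) ≡ indicator (not (does (meets? x xs))) + classes xs
    classes-∷ x xs
      with does (meets? x xs) | meets-deduplicate x xs
         | length-remove x (Unique.deduplicate-! (record { isDecEquivalence = E }) xs)
    ... | true  | eq | e rewrite eq = e
    ... | false | eq | e rewrite eq = cong suc e

    classes-unique : ∀ {xs} → AllPairs (λ y z → ¬ R y z) xs → classes xs ≡ length xs
    classes-unique []                           = refl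
    classes-unique {x ∷ xs} (x≁xs ∷ xs!) = begin
      classes (x ∷ xs)                                   ≡⟨ classes-∷ x xs ⟩
      indicator (not (does (meets? x xs))) + classes xs
        ≡⟨ cong (λ β → indicator (not β) + classes xs) (dec-false (meets? x xs) none) ⟩
      suc (classes xs)                                   ≡⟨ cong suc (classes-unique xs!) ⟩
      suc (length xs)                                    ∎
      where
      open ≡-Reasoning
      none : ¬ Any (R x) xs
      none = λ p → All.lookupAny x≁xs p .proj₁ (All.lookupAny x≁xs p .proj₂)

  module _ {A : Set} {R R′ : Rel A ℓ} (E : IsDecEquivalence R) (E′ : IsDecEquivalence R′) where

    private
      module C  = Classes E
      module C′ = Classes E′

    classes-cong : (∀ {u w} → R u w ⇔ R′ u w) → ∀ xs → C.classes xs ≡ C′.classes xs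
    classes-cong R⇔R′ []       = refl
    classes-cong R⇔R′ (x ∷ xs) = begin
      C.classes (x ∷ xs)                                       ≡⟨ C.classes-∷ x xs ⟩
      indicator (not (does (C.meets? x xs))) + C.classes xs
        ≡⟨ cong₂ (λ β c → indicator (not β) + c)
             (does-⇔ (mk⇔ (Any.map (Equivalence.to R⇔R′)) (Any.map (Equivalence.from R⇔R′)))
                     (C.meets? x xs) (C′.meets? x xs))
             (classes-cong R⇔R′ xs) ⟩
      indicator (not (does (C′.meets? x xs))) + C′.classes xs  ≡⟨ C′.classes-∷ x xs ⟨
      C′.classes (x ∷ xs)                                      ∎
      where open ≡-Reasoning

    module _ {s t} (s≁t : ¬ R s t)
             (R′⇔ : ∀ {u w} → R′ u w ⇔ (R u w ⊎ (R u s × R t w ⊎ R u t × R s w))) where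

      open Equivalence
      open ≡-Reasoning

      private
        σ τ : List A → Bool
        σ xs = does (C.meets? s xs)
        τ xs = does (C.meets? t xs)

        meets-s : ∀ {x} xs → R s x → does (C.meets? x xs) ≡ σ xs
        meets-s xs r = does-⇔ (mk⇔ (Any.map (C.R-trans r)) (Any.map (C.R-trans (C.R-sym r))))
          (C.meets? _ xs) (C.meets? s xs)

        meets-t : ∀ {x} xs → R t x → does (C.meets? x xs) ≡ τ xs
        meets-t xs r = does-⇔ (mk⇔ (Any.map (C.R-trans r)) (Any.map (C.R-trans (C.R-sym r))))
          (C.meets? _ xs) (C.meets? t xs)

        meets′-s : ∀ {x} xs → R s x → does (C′.meets? x xs) ≡ σ xs ∨ τ xs
        meets′-s {x} xs r = does-⇔ (mk⇔ (go ∘ Any.map (R′⇔ .to)) back)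
          (C′.meets? x xs) (C.meets? s xs ⊎-dec C.meets? t xs)
          where
          go : ∀ {ys} → Any (λ z → R x z ⊎ (R x s × R t z ⊎ R x t × R s z)) ys →
               Any (R s) ys ⊎ Any (R t) ys
          go (here (inj₁ q))              = inj₁ (here (C.R-trans r q))
          go (here (inj₂ (inj₁ (_ , q)))) = inj₂ (here q)
          go (here (inj₂ (inj₂ (_ , q)))) = inj₁ (here q)
          go (there p)                    = [ inj₁ ∘ there , inj₂ ∘ there ]′ (go p)
          back : Any (R s) xs ⊎ Any (R t) xs → Any (R′ x) xs
          back (inj₁ p) = Any.map (λ q → R′⇔ .from (inj₁ (C.R-trans (C.R-sym r) q))) p
          back (inj₂ p) = Any.map (λ q → R′⇔ .from (inj₂ (inj₁ (C.R-sym r , q)))) p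

        meets′-t : ∀ {x} xs → R t x → does (C′.meets? x xs) ≡ σ xs ∨ τ xs
        meets′-t {x} xs r = does-⇔ (mk⇔ (go ∘ Any.map (R′⇔ .to)) back)
          (C′.meets? x xs) (C.meets? s xs ⊎-dec C.meets? t xs)
          where
          go : ∀ {ys} → Any (λ z → R x z ⊎ (R x s × R t z ⊎ R x t × R s z)) ys →
               Any (R s) ys ⊎ Any (R t) ys
          go (here (inj₁ q))              = inj₂ (here (C.R-trans r q))
          go (here (inj₂ (inj₁ (_ , q)))) = inj₂ (here q)
          go (here (inj₂ (inj₂ (_ , q)))) = inj₁ (here q)
          go (there p)                    = [ inj₁ ∘ there , inj₂ ∘ there ]′ (go p)
          back : Any (R s) xs ⊎ Any (R t) xs → Any (R′ x) xs
          back (inj₁ p) = Any.map (λ q → R′⇔ .from (inj₂ (inj₂ (C.R-sym r , q)))) p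
          back (inj₂ p) = Any.map (λ q → R′⇔ .from (inj₁ (C.R-trans (C.R-sym r) q))) p

        meets′-other : ∀ {x} xs → ¬ R s x → ¬ R t x → does (C′.meets? x xs) ≡ does (C.meets? x xs)
        meets′-other {x} xs s≁x t≁x = does-⇔
          (mk⇔ (Any.map (simplify ∘ R′⇔ .to)) (Any.map (R′⇔ .from ∘ inj₁)))
          (C′.meets? x xs) (C.meets? x xs)
          where
          simplify : ∀ {z} → R x z ⊎ (R x s × R t z ⊎ R x t × R s z) → R x z
          simplify (inj₁ q)              = q
          simplify (inj₂ (inj₁ (q , _))) = contradiction (C.R-sym q) s≁x
          simplify (inj₂ (inj₂ (q , _))) = contradiction (C.R-sym q) t≁x

      -- Passing from `R` to `R′` fuses the classes of `s` and `t`, which loses a class only if the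
      -- list meets both. Arbitrary lists make the induction possible; on the list of all vertices
      -- both classes are met.
      classes-merge : ∀ xs → C.classes xs ≡ indicator (σ xs ∧ τ xs) + C′.classes xs
      classes-merge []       = refl
      classes-merge (x ∷ xs) with C.classes-∷ x xs | C′.classes-∷ x xs | classes-merge xs | s C.≟ x | t C.≟ x
      ... | e | e′ | ih | yes sRx | yes tRx = contradiction (C.R-trans sRx (C.R-sym tRx)) s≁t
      -- With [β] for `indicator β`, what remains is [¬σ] + [σ ∧ τ] = [τ] + [¬(σ ∨ τ)], checked on
      -- all truth values; the case of `t` is symmetric.
      ... | e | e′ | ih | yes sRx | no _
        rewrite e | e′ | ih | meets-s xs sRx | meets′-s xs sRx
        with σ xs | τ xs
      ...   | true  | true  = refl
      ...   | true  | false = refl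
      ...   | false | true  = refl
      ...   | false | false = refl
      classes-merge (x ∷ xs) | e | e′ | ih | no _ | yes tRx
        rewrite e | e′ | ih | meets-t xs tRx | meets′-t xs tRx
        with σ xs | τ xs
      ...   | true  | true  = refl
      ...   | true  | false = refl
      ...   | false | true  = refl
      ...   | false | false = refl
      classes-merge (x ∷ xs) | e | e′ | ih | no s≁x | no t≁x
        rewrite e | e′ | ih | meets′-other xs s≁x t≁x
        with does (C.meets? x xs) | σ xs ∧ τ xs
      ...   | true  | _     = refl
      ...   | false | true  = refl
      ...   | false | false = refl

  -- Rank and nullity of an edge list

  Connected-isDecEquivalence : (G : Graph v) → IsDecEquivalence (Connected G)
  Connected-isDecEquivalence G = record
    { isEquivalence = EqC.isEquivalence _
    ; _≟_           = connected?  G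
    }

  connected-sym : (G : Graph v) → ∀ {u w} → Connected G u w → Connected G w u
  connected-sym G = EqC.symmetric _

  conn : Graph v → Fin v → Fin v → Bool
  conn G s t = does (connected? G s t)

  -- The size of the spanning forest built greedily from the end of the list. Unlike `r` it follows
  -- the edges, so it admits induction on them and evaluates on a concrete edge list even when the
  -- number of vertices is symbolic.
  rank : Graph v → ℕ
  rank []            = 0
  rank ((s , t) ∷ G) = indicator (not (conn G s t)) + rank G

  -- An edge between connected vertices can be bypassed and changes no class; any other edge merges
  -- exactly two classes.
  k-∷ : ∀ (G : Graph v) s t → k G ≡ indicator (not (conn G s t)) + k ((s , t) ∷ G)
  k-∷ {v} G s t with connected? G s t
  ... | yes s~t = classes-cong (Connected-isDecEquivalence G) (Connected-isDecEquivalence ((s , t) ∷ G))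
    (mk⇔ (EqC.map there) (bypass ∘ connected-∷⁻)) (allFin v)
    where
    bypass : ∀ {u w} → Connected G u w ⊎ (Connected G u s × Connected G t w ⊎ Connected G u t × Connected G s w) →
             Connected G u w
    bypass (inj₁ p)              = p
    bypass (inj₂ (inj₁ (p , q))) = p ◅◅ s~t ◅◅ q
    bypass (inj₂ (inj₂ (p , q))) = p ◅◅ connected-sym G s~t ◅◅ q
  ... | no s≁t = subst (λ β → k G ≡ indicator β + k ((s , t) ∷ G))
    (cong₂ _∧_ (dec-true (meets? s) (self s)) (dec-true (meets? t) (self t)))
    (classes-merge (Connected-isDecEquivalence G) (Connected-isDecEquivalence ((s , t) ∷ G))
      s≁t (mk⇔ connected-∷⁻ connected-∷⁺) (allFin v))
    where
    meets? = λ u → Classes.meets? (Connected-isDecEquivalence G) u (allFin v)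
    self : ∀ u → Any (Connected G u) (allFin v)
    self u = Any.map (λ { refl → ε }) (∈-allFin u)

  k-[] : k {v} [] ≡ v
  k-[] {v} = trans
    (Classes.classes-unique (Connected-isDecEquivalence {v} []) (AllPairs-map (allFin⁺ v)))
    (length-tabulate id)
    where
    AllPairs-map : ∀ {xs : List (Fin v)} → Unique xs → AllPairs (λ s t → ¬ Connected {v} [] s t) xs
    AllPairs-map []         = []
    AllPairs-map (x≢ ∷ xs!) =
      All.map (λ { x≢y ε → x≢y refl ; _ (fwd () ◅ _) ; _ (bwd () ◅ _) }) x≢ ∷ AllPairs-map xs!

  k+rank : (G : Graph v) → k G + rank G ≡ v
  k+rank []            = trans (ℕ.+-identityʳ _) k-[]
  k+rank ((s , t) ∷ G) = begin
    k ((s , t) ∷ G) + (i + rank G)  ≡⟨ solve 3 (λ a b c → a :+ (b :+ c) := (b :+ a) :+ c) refl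
                                         (k ((s , t) ∷ G)) i (rank G) ⟩
    (i + k ((s , t) ∷ G)) + rank G  ≡⟨ cong (_+ rank G) (k-∷ G s t) ⟨
    k G + rank G                    ≡⟨ k+rank G ⟩
    _                               ∎
    where
    open ≡-Reasoning
    open +-*-Solver
    i = indicator (not (conn G s t))

  r≡rank : (G : Graph v) → r G ≡ rank G
  r≡rank {v} G = trans (cong (_∸ k G) (sym (k+rank G))) (ℕ.m+n∸m≡n (k G) (rank G))

  rank≤length : (G : Graph v) → rank G ≤ length G
  rank≤length []            = z≤n
  rank≤length ((s , t) ∷ G) with conn G s t
  ... | true  = ℕ.m≤n⇒m≤1+n (rank≤length G)
  ... | false = s≤s (rank≤length G)

  nullity : Graph v → ℕ
  nullity G = length G ∸ rank G

  n≡nullity : (G : Graph v) → n G ≡ nullity G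
  n≡nullity {v} G = begin
    (length G + k G) ∸ v                   ≡⟨ cong₂ _∸_ (+-comm (length G) (k G)) (sym (k+rank G)) ⟩
    (k G + length G) ∸ (k G + rank G)      ≡⟨ ℕ.[m+n]∸[m+o]≡n∸o (k G) (length G) (rank G) ⟩
    length G ∸ rank G                      ∎
    where open ≡-Reasoning

  -- With at least one vertex, `k G` computes to a successor, so taking predecessors in `k+rank G`
  -- gives the bound.
  rank<v : (G : Graph (suc v)) → rank G ≤ v
  rank<v G = ℕ.m+n≤o⇒n≤o (ℕ.pred (k G)) (ℕ.≤-reflexive (cong ℕ.pred (k+rank G)))

  connected-mono : ∀ {G G′ : Graph v} → G ⊆ G′ → ∀ {u w} → Connected G u w → Connected G′ u w
  connected-mono G⊆G′ = EqC.map G⊆G′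

  connected-↭ : ∀ {G G′ : Graph v} → G ↭ G′ → ∀ {u w} → Connected G u w ⇔ Connected G′ u w
  connected-↭ p = mk⇔ (connected-mono (∈-resp-↭ p)) (connected-mono (∈-resp-↭ (↭-sym p)))

  conn-↭ : ∀ {G G′ : Graph v} → G ↭ G′ → ∀ u w → conn G u w ≡ conn G′ u w
  conn-↭ {G = G} {G′} p u w = does-⇔ (connected-↭ p) (connected? G u w) (connected? G′ u w)

  -- The recursion for `rank` depends on the order of the edges, but `k` depends only on
  -- connectivity, and `k+rank` carries the invariance over.
  rank-↭ : ∀ {G G′ : Graph v} → G ↭ G′ → rank G ≡ rank G′
  rank-↭ {v} {G} {G′} p = ℕ.+-cancelˡ-≡ (k G) _ _ (begin
    k G + rank G    ≡⟨ k+rank G ⟩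
    v               ≡⟨ k+rank G′ ⟨
    k G′ + rank G′  ≡⟨ cong (_+ rank G′) (classes-cong (Connected-isDecEquivalence G)
                         (Connected-isDecEquivalence G′) (connected-↭ p) (allFin v)) ⟨
    k G + rank G′   ∎)
    where open ≡-Reasoning

  -- Replacing one side of a two-vertex separation by an edge

  bridge : Bool → Fin v → Fin v → Graph v
  bridge true  s t = (s , t) ∷ []
  bridge false s t = []

  -- Since A and B share only the vertices p and q, all that A sees of B is
  -- whether B joins p to q.
  module Separation {A B : Graph v} {p q : Fin v} (P Q : Fin v → Set)
    (P∩Q : ∀ {γ} → P γ → Q γ → γ ≡ p ⊎ γ ≡ q)
    (A⊆P : ∀ {s t} → (s , t) ∈ A → P s × P t)
    (B⊆Q : ∀ {s t} → (s , t) ∈ B → Q s × Q t)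
    where

    private
      D : Graph v
      D = A ++ bridge (conn B p q) p q

      bridged : Connected B p q → Connected D p q
      bridged c with connected? B p q
      ... | yes _ = fwd (∈-++⁺ʳ A (here refl)) ◅ ε
      ... | no ¬c = contradiction c ¬c

      A⊆D : ∀ {s t} → SymClosure (λ s t → (s , t) ∈ A) s t → Connected D s t
      A⊆D (fwd e) = fwd (∈-++⁺ˡ e) ◅ ε
      A⊆D (bwd e) = bwd (∈-++⁺ˡ e) ◅ ε

      -- The invariant of a walk in `A ++ B` that starts at `α` and has arrived at `γ`: either it is
      -- already simulated in `D`, or it is on the side of `B`, simulated in `D` up to `p` or `q`
      -- and continued from there within `B`.
      Reached : Fin v → Fin v → Set
      Reached α γ = P γ × Connected D α γ ⊎
        Q γ × (Connected D α p × Connected B p γ ⊎ Connected D α q × Connected B q γ)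

      -- A walk returns from `B` only at `p` or `q`. If it entered at the other one, its stretch
      -- inside `B` proves that `D` contains the bridge.
      settle : ∀ {α γ} → P γ → Reached α γ → Connected D α γ
      settle Pγ (inj₁ (_ , c)) = c
      settle Pγ (inj₂ (Qγ , c)) with P∩Q Pγ Qγ | c
      ... | inj₁ refl | inj₁ (d , _) = d
      ... | inj₁ refl | inj₂ (d , c) = d ◅◅ connected-sym D (bridged (connected-sym B c))
      ... | inj₂ refl | inj₁ (d , c) = d ◅◅ bridged c
      ... | inj₂ refl | inj₂ (d , _) = d

      depart : ∀ {α γ} → Q γ → Reached α γ →
               Connected D α p × Connected B p γ ⊎ Connected D α q × Connected B q γ
      depart Qγ (inj₂ (_ , c)) = c
      depart Qγ (inj₁ (Pγ , c)) with P∩Q Pγ Qγ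
      ... | inj₁ refl = inj₁ (c , ε)
      ... | inj₂ refl = inj₂ (c , ε)

      extend : ∀ {α γ δ} → Connected B γ δ →
               Connected D α p × Connected B p γ ⊎ Connected D α q × Connected B q γ →
               Connected D α p × Connected B p δ ⊎ Connected D α q × Connected B q δ
      extend e (inj₁ (d , c)) = inj₁ (d , c ◅◅ e)
      extend e (inj₂ (d , c)) = inj₂ (d , c ◅◅ e)

      step : ∀ {α γ δ} → SymClosure (λ s t → (s , t) ∈ A ++ B) γ δ → Reached α γ → Reached α δ
      step (fwd e) c with ∈-++⁻ A e
      ... | inj₁ a = let Pγ , Pδ = A⊆P a in inj₁ (Pδ , settle Pγ c ◅◅ A⊆D (fwd a))
      ... | inj₂ b = let Qγ , Qδ = B⊆Q b in inj₂ (Qδ , extend (fwd b ◅ ε) (depart Qγ c))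
      step (bwd e) c with ∈-++⁻ A e
      ... | inj₁ a = let Pδ , Pγ = A⊆P a in inj₁ (Pδ , settle Pγ c ◅◅ A⊆D (bwd a))
      ... | inj₂ b = let Qδ , Qγ = B⊆Q b in inj₂ (Qδ , extend (bwd b ◅ ε) (depart Qγ c))

      walk : ∀ {α γ β} → Reached α γ → Connected (A ++ B) γ β → Reached α β
      walk c ε       = c
      walk c (e ◅ p) = walk (step e c) p

      restore : ∀ {s t} → (s , t) ∈ D → Connected (A ++ B) s t
      restore e with ∈-++⁻ A e
      ... | inj₁ a = fwd (∈-++⁺ˡ a) ◅ ε
      ... | inj₂ b with connected? B p q | b
      ...   | yes c | here refl = connected-mono (∈-++⁺ʳ A) c

    connected-bridge : ∀ {α β} → P α → P β →
      Connected (A ++ B) α β ⇔ Connected (A ++ bridge (conn B p q) p q) α β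
    connected-bridge Pα Pβ = mk⇔
      (λ c → settle Pβ (walk (inj₁ (Pα , ε)) c))
      (EqC.fold (EqC.isEquivalence _) restore)

  -- Gluing one copy to the rest along two vertices

  map² : (Fin v → Fin w) → Graph v → Graph w
  map² f = map (Product.map f f)

  connected-map : ∀ {f : Fin v → Fin w} → Injective _≡_ _≡_ f → (G : Graph v) → ∀ {u u′} →
                  Connected (map² f G) (f u) (f u′) ⇔ Connected G u u′
  connected-map {f = f} f-inj G = mk⇔ (λ p → go p refl) (EqC.gmap f (∈-map⁺ _))
    where
    -- The end of the walk is a variable with an equation, since a walk ending in `f u′` cannot be
    -- matched against `ε`.
    go : ∀ {u u′ β} → Connected (map² f G) (f u) β → β ≡ f u′ → Connected G u u′
    go ε eq with refl ← f-inj eq = ε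
    go (fwd e ◅ p) eq with (a , b) , e′ , ab≡ ← ∈-map⁻ _ e
      with refl ← f-inj (cong proj₁ ab≡) | refl ← cong proj₂ ab≡ = fwd e′ ◅ go p eq
    go (bwd e ◅ p) eq with (a , b) , e′ , ab≡ ← ∈-map⁻ _ e
      with refl ← f-inj (cong proj₂ ab≡) | refl ← cong proj₁ ab≡ = bwd e′ ◅ go p eq

  module Gluing {f : Fin v → Fin w} (f-inj : Injective _≡_ _≡_ f) {s t : Fin v} (s≢t : s ≢ t)
    {K : Graph w} (Q : Fin w → Set)
    (Q∩f : ∀ {u} → Q (f u) → u ≡ s ⊎ u ≡ t)
    (K⊆Q : ∀ {α β} → (α , β) ∈ K → Q α × Q β)
    where

    private
      P : Fin w → Set
      P γ = ∃ λ u → γ ≡ f u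

      P∩Q : ∀ {γ} → P γ → Q γ → γ ≡ f s ⊎ γ ≡ f t
      P∩Q (u , refl) Qγ with Q∩f Qγ
      ... | inj₁ refl = inj₁ refl
      ... | inj₂ refl = inj₂ refl

      map⊆P : ∀ H {α β} → (α , β) ∈ map² f H → P α × P β
      map⊆P H e with (a , b) , _ , eq ← ∈-map⁻ _ e = (a , cong proj₁ eq) , (b , cong proj₂ eq)

      -- What K contributes to connectivity inside the copy.
      J : Graph v
      J = bridge (conn K (f s) (f t)) s t

      map-bridge : ∀ c → bridge c (f s) (f t) ≡ map² f (bridge c s t)
      map-bridge true  = refl
      map-bridge false = refl

      conn-inner : ∀ H u u′ → conn (map² f H ++ K) (f u) (f u′) ≡ conn (H ++ J) u u′
      conn-inner H u u′ = does-⇔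
        (mk⇔ (to (connected-map f-inj (H ++ J)) ∘ subst C eq ∘ to br)
             (from br ∘ subst C (sym eq) ∘ from (connected-map f-inj (H ++ J))))
        (connected? (map² f H ++ K) (f u) (f u′)) (connected? (H ++ J) u u′)
        where
        open Equivalence
        C : Graph w → Set
        C G = Connected G (f u) (f u′)
        eq : map² f H ++ bridge (conn K (f s) (f t)) (f s) (f t) ≡ map² f (H ++ J)
        eq = trans (cong (map² f H ++_) (map-bridge _)) (sym (map-++ _ H J))
        br = Separation.connected-bridge P Q P∩Q (map⊆P H) K⊆Q (u , refl) (u′ , refl)

      -- By `conn-inner` each edge of `H` merges two components over `K` exactly when it does so
      -- over `J`. Adding the edges one by one therefore raises both ranks equally, starting from
      -- `rank K` and `rank J`.
      rank-inner : ∀ H → rank (map² f H ++ K) + rank J ≡ rank K + rank (H ++ J)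
      rank-inner []            = refl
      rank-inner ((a , b) ∷ H) rewrite conn-inner H a b = begin
        (i + rank (map² f H ++ K)) + rank J  ≡⟨ +-assoc i _ _ ⟩
        i + (rank (map² f H ++ K) + rank J)  ≡⟨ cong (i +_) (rank-inner H) ⟩
        i + (rank K + rank (H ++ J))         ≡⟨ solve 3 (λ a b c → a :+ (b :+ c) := b :+ (a :+ c)) refl
                                                  i (rank K) (rank (H ++ J)) ⟩
        rank K + (i + rank (H ++ J))         ∎
        where
        open ≡-Reasoning
        open +-*-Solver
        i = indicator (not (conn (H ++ J) a b))

      conn-empty : conn [] s t ≡ false
      conn-empty = dec-false (connected? [] s t) λ { ε → s≢t refl ; (fwd () ◅ _) ; (bwd () ◅ _) }

      rank-bridge : ∀ (G : Graph v) c → rank (bridge c s t ++ G) ≡ indicator (c ∧ not (conn G s t)) + rank G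
      rank-bridge G true  = refl
      rank-bridge G false = refl

    -- Let h and c say whether `H` and `K` join the two common vertices. Gluing gives `rank H` +
    -- `rank K`, less one if both h and c hold, because a cycle closes. The bridge raises `rank K`
    -- by one if h holds and c fails. The two differ by `indicator` of h in every case.
    rank-glue : ∀ H → rank (map² f H ++ K) + indicator (conn H s t) ≡
                      rank (bridge (conn H s t) (f s) (f t) ++ K) + rank H
    rank-glue H
      with rank-inner H
    ... | e rewrite rank-↭ (++-comm H J) | rank-bridge H (conn K (f s) (f t))
      with conn H s t | conn K (f s) (f t) in eq
    ... | h | c = go h c eq e
      where
      go : ∀ h c → conn K (f s) (f t) ≡ c →
        rank (map² f H ++ K) + rank (bridge c s t) ≡ rank K + (indicator (c ∧ not h) + rank H) →
        rank (map² f H ++ K) + indicator h ≡ rank (bridge h (f s) (f t) ++ K) + rank H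
      go true  true  eq e rewrite eq | conn-empty = e
      go true  false eq e rewrite eq = trans (+-suc _ 0) (cong suc e)
      -- The edge of `J` enlarges `H` by one in rank; this cancels against the rank of `J` itself on
      -- the left.
      go false true  eq e rewrite conn-empty =
        trans (ℕ.+-identityʳ _) (ℕ.suc-injective
          (trans (sym (+-comm _ 1)) (trans e (+-suc (rank K) (rank H)))))
      go false false eq e = e

    -- `Separation` with the roles exchanged: here `K` is kept and the copy is what shrinks to a
    -- bridge.
    conn-glue : ∀ H {α β} → Q α → Q β →
      conn (map² f H ++ K) α β ≡ conn (bridge (conn H s t) (f s) (f t) ++ K) α β
    conn-glue H {α} {β} Qα Qβ = begin
      conn (map² f H ++ K) α β                              ≡⟨ conn-↭ (++-comm (map² f H) K) α β ⟩
      conn (K ++ map² f H) α β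
        ≡⟨ does-⇔ (Separation.connected-bridge Q P (λ q p → P∩Q p q) K⊆Q (map⊆P H) Qα Qβ)
                  (connected? (K ++ map² f H) α β) (connected? (K ++ bridge _ (f s) (f t)) α β) ⟩
      conn (K ++ bridge (conn (map² f H) (f s) (f t)) (f s) (f t)) α β
        ≡⟨ cong (λ c → conn (K ++ bridge c (f s) (f t)) α β)
                (does-⇔ (connected-map f-inj H) (connected? (map² f H) (f s) (f t)) (connected? H s t)) ⟩
      conn (K ++ bridge (conn H s t) (f s) (f t)) α β
        ≡⟨ conn-↭ (++-comm K (bridge (conn H s t) (f s) (f t))) α β ⟩
      conn (bridge (conn H s t) (f s) (f t) ++ K) α β       ∎
      where open ≡-Reasoning

  -- Contracting the copies one after another

  Within : (Fin v → Set) → Graph v → Set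
  Within Q K = ∀ {α β} → (α , β) ∈ K → Q α × Q β

  within-++ : ∀ {Q : Fin v → Set} A {B} → Within Q A → Within Q B → Within Q (A ++ B)
  within-++ A A⊆Q B⊆Q e = [ A⊆Q , B⊆Q ]′ (∈-++⁻ A e)

  within-bridge : ∀ {Q : Fin v → Set} c {s t} → Q s → Q t → Within Q (bridge c s t)
  within-bridge true Qs Qt (here refl) = Qs , Qt

  count : ∀ {l} → Vec Bool l → ℕ
  count cs = Vec.sum (Vec.map indicator cs)

  linked : ∀ {m} → Graph (order m) → Bool
  linked {m} H = conn H (X m) (Y m)

  module _ (m : ℕ) where

    -- The last clause of `glue` reduces only once the index of the copy is known.
    glue-inner : ∀ i u → glue m i (2 ↑ʳ u) ≡ 4 ↑ʳ combine i u
    glue-inner 0F u = refl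
    glue-inner 1F u = refl
    glue-inner 2F u = refl
    glue-inner 3F u = refl

    -- Negative, so that it admits the special vertices of copy `i` as well as all other copies. For
    -- X, Y, a and b it holds by constructor clash, whatever `inner m` is.
    Outside : Fin 4 → Fin (order (suc m)) → Set
    Outside i α = ∀ (u : Fin (inner m)) → α ≢ 4 ↑ʳ combine i u

    Special : Fin (order (suc m)) → Set
    Special α = ∀ i → Outside i α

    source target : Fin 4 → Fin (order (suc m))
    source i = glue m i (X m)
    target i = glue m i (Y m)

    source-special : ∀ i → Special (source i)
    source-special 0F _ _ ()
    source-special 1F _ _ ()
    source-special 2F _ _ ()
    source-special 3F _ _ ()

    target-special : ∀ i → Special (target i)
    target-special 0F _ _ ()
    target-special 1F _ _ ()
    target-special 2F _ _ ()
    target-special 3F _ _ ()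

    glue-outside : ∀ {i j} → i ≢ j → ∀ w → Outside i (glue m j w)
    glue-outside {i} {j} i≢j 0F                    = source-special j i
    glue-outside {i} {j} i≢j 1F                    = target-special j i
    glue-outside {i} {j} i≢j (Fin.suc (Fin.suc w)) u eq =
      i≢j (sym (proj₁ (combine-injective j w i u (↑ʳ-injective 4 _ _ (trans (sym (glue-inner j w)) eq)))))

    glue-terminal : ∀ i {w} → Outside i (glue m i w) → w ≡ X m ⊎ w ≡ Y m
    glue-terminal i {0F} _                    = inj₁ refl
    glue-terminal i {1F} _                    = inj₂ refl
    glue-terminal i {Fin.suc (Fin.suc u)} out = contradiction (glue-inner i u) (out u)

    glue-injective : ∀ i → Injective _≡_ _≡_ (glue m i)
    glue-injective i {0F} {0F} _ = refl
    glue-injective i {1F} {1F} _ = refl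
    glue-injective i {Fin.suc (Fin.suc u)} {Fin.suc (Fin.suc u′)} eq =
      cong (2 ↑ʳ_) (proj₂ (combine-injective i u i u′
        (↑ʳ-injective 4 _ _ (trans (sym (glue-inner i u)) (trans eq (glue-inner i u′))))))
    glue-injective i {0F} {Fin.suc (Fin.suc u)} eq =
      contradiction (trans eq (glue-inner i u)) (source-special i i u)
    glue-injective i {1F} {Fin.suc (Fin.suc u)} eq =
      contradiction (trans eq (glue-inner i u)) (target-special i i u)
    glue-injective i {Fin.suc (Fin.suc u)} {0F} eq =
      contradiction (trans (sym eq) (glue-inner i u)) (source-special i i u)
    glue-injective i {Fin.suc (Fin.suc u)} {1F} eq =
      contradiction (trans (sym eq) (glue-inner i u)) (target-special i i u)
    glue-injective 0F {0F} {1F} ()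
    glue-injective 1F {0F} {1F} ()
    glue-injective 2F {0F} {1F} ()
    glue-injective 3F {0F} {1F} ()
    glue-injective 0F {1F} {0F} ()
    glue-injective 1F {1F} {0F} ()
    glue-injective 2F {1F} {0F} ()
    glue-injective 3F {1F} {0F} ()

    copies : (is : List (Fin 4)) → Vec (Graph (order m)) (length is) → Graph (order (suc m))
    copies []       []       = []
    copies (i ∷ is) (H ∷ Hs) = copy m i H ++ copies is Hs

    copies-replicate : ∀ is H → copies is (Vec.replicate _ H) ≡ concatMap (λ i → copy m i H) is
    copies-replicate []       H = refl
    copies-replicate (i ∷ is) H = cong (copy m i H ++_) (copies-replicate is H)

    -- What is left of L ++ copies is Hs when each copy is contracted to an edge
    -- or to nothing, according to whether it joins its special vertices.
    skeleton : Graph (order (suc m)) → (is : List (Fin 4)) → Vec Bool (length is) → Graph (order (suc m))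
    skeleton L []       []       = L
    skeleton L (i ∷ is) (c ∷ cs) = skeleton (bridge c (source i) (target i) ++ L) is cs

    private
      within-copies : ∀ {i is} Hs → All (i ≢_) is → Within (Outside i) (copies is Hs)
      within-copies {i} {j ∷ is} (H ∷ Hs) (i≢j ∷ i∉is) =
        within-++ (copy m j H)
          (λ e → let (a , b) , _ , eq = ∈-map⁻ _ e
                 in subst (Outside i) (sym (cong proj₁ eq)) (glue-outside i≢j a)
                  , subst (Outside i) (sym (cong proj₂ eq)) (glue-outside i≢j b))
          (within-copies Hs i∉is)
      within-copies {is = []} [] [] ()

    module _ (L : Graph (order (suc m))) {i : Fin 4} {is : List (Fin 4)} (i∉is : All (i ≢_) is)
             (L-special : Within Special L)
             (H : Graph (order m)) (Hs : Vec (Graph (order m)) (length is)) where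

      private
        module Glue = Gluing (glue-injective i) {s = X m} {t = Y m} (λ ())
          {K = L ++ copies is Hs} (Outside i) (glue-terminal i)
          (within-++ L (λ e → Product.map (λ s → s i) (λ s → s i) (L-special e)) (within-copies Hs i∉is))

        L′ : Graph (order (suc m))
        L′ = bridge (linked {m} H) (source i) (target i) ++ L

      -- `Gluing` treats `L` and all remaining copies together as the rest `K`, which requires copy
      -- `i` at the front; `shifts` moves it there. The new bridge joins `L`, whose edges stay
      -- outside every later copy.
      rank-glue-copy : rank (L ++ copies (i ∷ is) (H ∷ Hs)) + indicator (linked {m} H) ≡
                       rank (L′ ++ copies is Hs) + rank H
      rank-glue-copy = begin
        rank (L ++ copies (i ∷ is) (H ∷ Hs)) + indicator (linked {m} H)
          ≡⟨ cong (_+ indicator (linked {m} H)) (rank-↭ (shifts L (copy m i H))) ⟩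
        rank (copy m i H ++ L ++ copies is Hs) + indicator (linked {m} H)
          ≡⟨ Glue.rank-glue H ⟩
        rank (bridge (linked {m} H) (source i) (target i) ++ L ++ copies is Hs) + rank H
          ≡⟨ cong (λ G → rank G + rank H) (++-assoc (bridge (linked {m} H) _ _) L _) ⟨
        rank (L′ ++ copies is Hs) + rank H ∎
        where open ≡-Reasoning

      conn-glue-copy : ∀ {α β} → Special α → Special β →
        conn (L ++ copies (i ∷ is) (H ∷ Hs)) α β ≡ conn (L′ ++ copies is Hs) α β
      conn-glue-copy {α} {β} Sα Sβ = begin
        conn (L ++ copies (i ∷ is) (H ∷ Hs)) α β
          ≡⟨ conn-↭ (shifts L (copy m i H)) α β ⟩
        conn (copy m i H ++ L ++ copies is Hs) α β
          ≡⟨ Glue.conn-glue H (Sα i) (Sβ i) ⟩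
        conn (bridge (linked {m} H) (source i) (target i) ++ L ++ copies is Hs) α β
          ≡⟨ cong (λ G → conn G α β) (++-assoc (bridge (linked {m} H) _ _) L _) ⟨
        conn (L′ ++ copies is Hs) α β ∎
        where open ≡-Reasoning

      -- Pure counting, put in the same form as `rank-glue-copy` so that subtracting the two leaves
      -- the nullity.
      length-glue-copy : length (L ++ copies (i ∷ is) (H ∷ Hs)) + indicator (linked {m} H) ≡
                         length (L′ ++ copies is Hs) + length H
      length-glue-copy = begin
        length (L ++ copy m i H ++ copies is Hs) + indicator (linked {m} H)
          ≡⟨ cong (_+ indicator (linked {m} H)) (↭-length (shifts L (copy m i H))) ⟩
        length (copy m i H ++ L ++ copies is Hs) + indicator (linked {m} H)
          ≡⟨ cong (_+ indicator (linked {m} H)) (trans (length-++ (copy m i H))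
               (cong (_+ length (L ++ copies is Hs)) (length-map _ H))) ⟩
        (length H + length (L ++ copies is Hs)) + indicator (linked {m} H)
          ≡⟨ solve 3 (λ a b c → (a :+ b) :+ c := (c :+ b) :+ a) refl
               (length H) (length (L ++ copies is Hs)) (indicator (linked {m} H)) ⟩
        (indicator (linked {m} H) + length (L ++ copies is Hs)) + length H
          ≡⟨ cong (λ l → (l + length (L ++ copies is Hs)) + length H) (length-bridge (linked {m} H)) ⟨
        (length (bridge (linked {m} H) (source i) (target i)) + length (L ++ copies is Hs)) + length H
          ≡⟨ cong (_+ length H) (length-++ (bridge (linked {m} H) _ _)) ⟨
        length (bridge (linked {m} H) (source i) (target i) ++ L ++ copies is Hs) + length H
          ≡⟨ cong (λ G → length G + length H) (++-assoc (bridge (linked {m} H) _ _) L _) ⟨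
        length (L′ ++ copies is Hs) + length H ∎
        where
        open ≡-Reasoning
        open +-*-Solver
        length-bridge : ∀ c → length (bridge c (source i) (target i)) ≡ indicator c
        length-bridge true  = refl
        length-bridge false = refl

      within-bridged : Within Special L′
      within-bridged = within-++ (bridge (linked {m} H) _ _)
        (within-bridge (linked {m} H) (source-special i) (target-special i)) L-special

    private
      accumulate : ∀ a b e {c d s t} → a + c ≡ b + d → b + s ≡ e + t → a + (c + s) ≡ e + (d + t)
      accumulate a b e {c} {d} {s} {t} p q = begin
        a + (c + s)  ≡⟨ +-assoc a c s ⟨
        (a + c) + s  ≡⟨ cong (_+ s) p ⟩
        (b + d) + s  ≡⟨ solve 3 (λ b d s → (b :+ d) :+ s := d :+ (b :+ s)) refl b d s ⟩
        d + (b + s)  ≡⟨ cong (d +_) q ⟩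
        d + (e + t)  ≡⟨ solve 3 (λ d e t → d :+ (e :+ t) := e :+ (d :+ t)) refl d e t ⟩
        e + (d + t)  ∎
        where
        open ≡-Reasoning
        open +-*-Solver

    linkeds : ∀ {l} → Vec (Graph (order m)) l → Vec Bool l
    linkeds = Vec.map (linked {m})

    -- Distinct indices ensure that the copies still to be contracted avoid the inner vertices of
    -- the current one.
    rank-copies : ∀ L {is} → Unique is → Within Special L → ∀ Hs →
      rank (L ++ copies is Hs) + count (linkeds Hs) ≡
      rank (skeleton L is (linkeds Hs)) + Vec.sum (Vec.map rank Hs)
    rank-copies L [] L-special [] = cong (λ G → rank G + 0) (++-identityʳ L)
    rank-copies L {i ∷ is} (i∉is ∷ is!) L-special (H ∷ Hs) =
      let L′ = bridge (linked {m} H) (source i) (target i) ++ L in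
      accumulate (rank (L ++ copies (i ∷ is) (H ∷ Hs))) (rank (L′ ++ copies is Hs))
                 (rank (skeleton L′ is (linkeds Hs)))
        (rank-glue-copy L i∉is L-special H Hs)
        (rank-copies L′ is! (within-bridged L i∉is L-special H Hs) Hs)

    length-copies : ∀ L {is} → Unique is → Within Special L → ∀ Hs →
      length (L ++ copies is Hs) + count (linkeds Hs) ≡
      length (skeleton L is (linkeds Hs)) + Vec.sum (Vec.map length Hs)
    length-copies L [] L-special [] = cong (λ G → length G + 0) (++-identityʳ L)
    length-copies L {i ∷ is} (i∉is ∷ is!) L-special (H ∷ Hs) =
      let L′ = bridge (linked {m} H) (source i) (target i) ++ L in
      accumulate (length (L ++ copies (i ∷ is) (H ∷ Hs))) (length (L′ ++ copies is Hs))
                 (length (skeleton L′ is (linkeds Hs)))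
        (length-glue-copy L i∉is L-special H Hs)
        (length-copies L′ is! (within-bridged L i∉is L-special H Hs) Hs)

    conn-copies : ∀ L {is} → Unique is → Within Special L → ∀ Hs {α β} → Special α → Special β →
      conn (L ++ copies is Hs) α β ≡ conn (skeleton L is (linkeds Hs)) α β
    conn-copies L [] L-special [] Sα Sβ = cong (λ G → conn G _ _) (++-identityʳ L)
    conn-copies L (i∉is ∷ is!) L-special (H ∷ Hs) Sα Sβ = trans
      (conn-glue-copy L i∉is L-special H Hs Sα Sβ)
      (conn-copies _ is! (within-bridged L i∉is L-special H Hs) Hs Sα Sβ)

    base : Bool → Graph (order (suc m))
    base e = bridge e (a m) (b m)

  -- Invariants of a glued graph in terms of its frame

  sum-+ : ∀ {A : Set} (f g {h} : A → ℕ) → (∀ x → f x + g x ≡ h x) → ∀ {l} (xs : Vec A l) →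
          Vec.sum (Vec.map f xs) + Vec.sum (Vec.map g xs) ≡ Vec.sum (Vec.map h xs)
  sum-+ f g eq [] = refl
  sum-+ f g eq (x ∷ xs) = begin
    (f x + F) + (g x + G′)  ≡⟨ solve 4 (λ a b c d → (a :+ b) :+ (c :+ d) := (a :+ c) :+ (b :+ d))
                                refl (f x) F (g x) G′ ⟩
    (f x + g x) + (F + G′)  ≡⟨ cong₂ _+_ (eq x) (sum-+ f g eq xs) ⟩
    _                       ∎
    where
    open ≡-Reasoning
    open +-*-Solver
    F  = Vec.sum (Vec.map f xs)
    G′ = Vec.sum (Vec.map g xs)

  all-Bool? : {P : Bool → Set} → (∀ β → Dec (P β)) → Dec (∀ β → P β)
  all-Bool? P? = map′ (λ { (t , f) true → t ; (t , f) false → f }) (λ p → p true , p false)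
    (P? true ×-dec P? false)

  all-Vec? : ∀ {l} {P : Vec Bool l → Set} → (∀ cs → Dec (P cs)) → Dec (∀ cs → P cs)
  all-Vec? {zero}  P? = map′ (λ { p [] → p }) (λ p → p []) (P? [])
  all-Vec? {suc l} P? = map′ (λ { p (c ∷ cs) → p c cs }) (λ p c cs → p (c ∷ cs))
    (all-Bool? λ c → all-Vec? λ cs → P? (c ∷ cs))

  module _ (m : ℕ) where

    frame : Bool → Vec Bool 4 → Graph (order (suc m))
    frame e cs = skeleton m (base m e) (allFin 4) cs

    framed : Bool → Vec (Graph (order m)) 4 → Graph (order (suc m))
    framed e Hs = base m e ++ copies m (allFin 4) Hs

    private
      base-special : ∀ e → Within (Special m) (base m e)
      base-special e = within-bridge e (λ _ _ ()) (λ _ _ ())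

    linked-framed : ∀ e Hs → linked {suc m} (framed e Hs) ≡ linked {suc m} (frame e (linkeds m Hs))
    linked-framed e Hs = conn-copies m (base m e) (allFin⁺ 4) (base-special e) Hs (λ _ _ ()) (λ _ _ ())

    rank-framed : ∀ e Hs → rank (framed e Hs) + count (linkeds m Hs) ≡
                           rank (frame e (linkeds m Hs)) + Vec.sum (Vec.map rank Hs)
    rank-framed e = rank-copies m (base m e) (allFin⁺ 4) (base-special e)

    -- The correction c appears in both the rank identity and the length identity, so it drops out
    -- of their difference. Adding `rank M + c` to both sides avoids truncated subtraction.
    nullity-framed : ∀ e Hs → nullity (framed e Hs) ≡
                              nullity (frame e (linkeds m Hs)) + Vec.sum (Vec.map nullity Hs)
    nullity-framed e Hs = ℕ.+-cancelʳ-≡ (rank M + c) _ _ (begin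
      nullity M + (rank M + c)    ≡⟨ +-assoc (nullity M) _ _ ⟨
      (nullity M + rank M) + c    ≡⟨ cong (_+ c) (nullity+rank M) ⟩
      length M + c                ≡⟨ length-copies m (base m e) (allFin⁺ 4) (base-special e) Hs ⟩
      length S + Vec.sum (Vec.map length Hs)
        ≡⟨ cong₂ _+_ (nullity+rank S) (sum-+ nullity rank nullity+rank Hs) ⟨
      (nullity S + rank S) + (νs + ρs)
        ≡⟨ solve 4 (λ a b c d → (a :+ b) :+ (c :+ d) := (a :+ c) :+ (b :+ d)) refl (nullity S) (rank S) νs ρs ⟩
      (nullity S + νs) + (rank S + ρs)  ≡⟨ cong ((nullity S + νs) +_) (rank-framed e Hs) ⟨
      (nullity S + νs) + (rank M + c)   ∎)
      where
      open ≡-Reasoning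
      open +-*-Solver
      M  = framed e Hs
      S  = frame e (linkeds m Hs)
      c  = count (linkeds m Hs)
      νs = Vec.sum (Vec.map nullity Hs)
      ρs = Vec.sum (Vec.map rank Hs)
      nullity+rank : ∀ {v} (G : Graph v) → nullity G + rank G ≡ length G
      nullity+rank G = ℕ.m∸n+n≡m (rank≤length G)

    -- The edges of a frame join only 0F, 1F, 2F and 3F, so its rank computes although
    -- m is a variable, and the 32 cases are decided by evaluation.
    count≤1+rank-frame : ∀ e cs → count cs ≤ suc (rank (frame e cs))
    count≤1+rank-frame = from-yes
      (all-Bool? λ e → all-Vec? λ cs → count cs ≤? suc (rank (frame e cs)))

  -- The rank of the whole graph, and coranks of its spanning subgraphs

  G-framed : ∀ m → G (suc m) ≡ framed m true (Vec.replicate 4 (G m))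
  G-framed m = cong ((a m , b m) ∷_) (sym (copies-replicate m (allFin 4) (G m)))

  linked-G : ∀ m → linked {m} (G m) ≡ true
  linked-G zero    = refl
  linked-G (suc m) = begin
    linked {suc m} (G (suc m))                                      ≡⟨ cong (linked {suc m}) (G-framed m) ⟩
    linked {suc m} (framed m true (Vec.replicate 4 (G m)))          ≡⟨ linked-framed m true (Vec.replicate 4 (G m)) ⟩
    linked {suc m} (frame m true (linkeds m (Vec.replicate 4 (G m))))
      ≡⟨ cong (λ c → linked {suc m} (frame m true (Vec.replicate 4 c))) (linked-G m) ⟩
    true                                                            ∎
    where open ≡-Reasoning

  rank-G : ∀ m → rank (G m) ≡ suc (inner m)
  rank-G zero    = refl
  rank-G (suc m) = ℕ.+-cancelʳ-≡ 4 _ _ (begin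
    rank (G (suc m)) + 4
      ≡⟨ cong₂ (λ H c → rank H + count (Vec.replicate 4 c)) (G-framed m) (sym (linked-G m)) ⟩
    rank (framed m true Gs) + count (linkeds m Gs)
      ≡⟨ rank-framed m true Gs ⟩
    rank (frame m true (linkeds m Gs)) + Vec.sum (Vec.map rank Gs)
      ≡⟨ cong₂ (λ c ρ → rank (frame m true (Vec.replicate 4 c)) + Vec.sum (Vec.replicate 4 ρ))
               (linked-G m) (rank-G m) ⟩
    -- With all five edges present the frame connects X, Y, a and b, hence has rank 3.
    3 + Vec.sum (Vec.replicate 4 (suc (inner m)))
      ≡⟨ solve 1 (λ i → con 3 :+ ((con 1 :+ i) :+ ((con 1 :+ i) :+ ((con 1 :+ i) :+ ((con 1 :+ i) :+ con 0))))
                   := con 3 :+ (con 4 :* i) :+ con 4) refl (inner m) ⟩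
    suc (inner (suc m)) + 4 ∎)
    where
    open ≡-Reasoning
    open +-*-Solver
    Gs = Vec.replicate 4 (G m)

  -- Written with `r` so that it is literally the exponent of `x - 1` in `term (G m) H`; `corank≡`
  -- translates to `rank`.
  corank : ∀ {m} → Graph (order m) → ℕ
  corank {m} H = r (G m) ∸ r H

  corank≡ : ∀ {m} (H : Graph (order m)) → corank {m} H ≡ suc (inner m) ∸ rank H
  corank≡ {m} H = cong₂ _∸_ (trans (r≡rank (G m)) (rank-G m)) (r≡rank H)

  corank+rank : ∀ {m} (H : Graph (order m)) → corank {m} H + rank H ≡ suc (inner m)
  corank+rank {m} H = trans (cong (_+ rank H) (corank≡ {m} H)) (ℕ.m∸n+n≡m (rank<v H))

  -- The amount by which the coranks of the four pieces exceed the corank of the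
  -- glued graph. The subtraction is exact by count≤1+rank-frame.
  excess : ∀ m → Bool → Vec Bool 4 → ℕ
  excess m e cs = suc (rank (frame m e cs)) ∸ count cs

  -- The coranks of the pieces are taken from a total of 4 + 4 `inner m`, that of the glued graph
  -- from 3 + 4 `inner m`. This surplus of one, together with `rank-framed`, produces the excess.
  corank-framed : ∀ m e Hs → corank {suc m} (framed m e Hs) + excess m e (linkeds m Hs) ≡
                             Vec.sum (Vec.map (corank {m}) Hs)
  -- Splitting `Hs` lets the sum of the constants `suc (inner m)` unfold into four summands.
  corank-framed m e Hs@(_ ∷ _ ∷ _ ∷ _ ∷ []) = ℕ.+-cancelʳ-≡ (rank M + c) _ _ (begin
    (κ + j) + (rank M + c)
      ≡⟨ solve 4 (λ κ j ρ c → (κ :+ j) :+ (ρ :+ c) := (κ :+ ρ) :+ (j :+ c)) refl κ j (rank M) c ⟩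
    (κ + rank M) + (j + c)
      ≡⟨ cong₂ _+_ (corank+rank {suc m} M) (ℕ.m∸n+n≡m (count≤1+rank-frame m e (linkeds m Hs))) ⟩
    suc (inner (suc m)) + suc (rank S)
      ≡⟨ solve 2 (λ i ρ → (con 3 :+ con 4 :* i) :+ (con 1 :+ ρ) :=
           ((con 1 :+ i) :+ ((con 1 :+ i) :+ ((con 1 :+ i) :+ ((con 1 :+ i) :+ con 0)))) :+ ρ)
           refl (inner m) (rank S) ⟩
    Vec.sum (Vec.map (λ _ → suc (inner m)) Hs) + rank S
      ≡⟨ cong (_+ rank S) (sum-+ (corank {m}) rank (corank+rank {m}) Hs) ⟨
    (κs + ρs) + rank S
      ≡⟨ solve 3 (λ κ ρ s → (κ :+ ρ) :+ s := κ :+ (s :+ ρ)) refl κs ρs (rank S) ⟩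
    κs + (rank S + ρs)
      ≡⟨ cong (κs +_) (rank-framed m e Hs) ⟨
    κs + (rank M + c) ∎)
    where
    open ≡-Reasoning
    open +-*-Solver
    M  = framed m e Hs
    S  = frame m e (linkeds m Hs)
    c  = count (linkeds m Hs)
    κ  = corank {suc m} M
    j  = excess m e (linkeds m Hs)
    κs = Vec.sum (Vec.map (corank {m}) Hs)
    ρs = Vec.sum (Vec.map rank Hs)

open Graphs

-- Sums over spanning subgraphs

module Sums {c ℓ} (R : CommutativeRing c ℓ) (x y : CommutativeRing.Carrier R) where

  open CommutativeRing R
  open Tutte R x y
  open import Algebra.Properties.CommutativeSemigroup +-commutativeSemigroup using (interchange)
  open import Relation.Binary.Reasoning.Setoid setoid

  infix 5 _when_

  _when_ : Carrier → Bool → Carrier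
  p when β = if β then p else 0#

  when-cong : ∀ {p q} β → p ≈ q → p when β ≈ q when β
  when-cong true  p≈q = p≈q
  when-cong false p≈q = refl

  when-* : ∀ β p q → (p when β) * q ≈ p * q when β
  when-* true  p q = refl
  when-* false p q = zeroˡ q

  ∑-cong : ∀ {f g : Graph v → Carrier} Hs → (∀ H → f H ≈ g H) → ∑[ Hs ] f ≈ ∑[ Hs ] g
  ∑-cong []       f≈g = refl
  ∑-cong (H ∷ Hs) f≈g = +-cong (f≈g H) (∑-cong Hs f≈g)

  ∑-++ : ∀ (f : Graph v → Carrier) Hs Ks → ∑[ Hs ++ Ks ] f ≈ ∑[ Hs ] f + ∑[ Ks ] f
  ∑-++ f []       Ks = sym (+-identityˡ _)
  ∑-++ f (H ∷ Hs) Ks = trans (+-congˡ (∑-++ f Hs Ks)) (sym (+-assoc _ _ _))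

  ∑-map : ∀ (f : Graph w → Carrier) (g : Graph v → Graph w) Hs → ∑[ map g Hs ] f ≈ ∑[ Hs ] (f ∘ g)
  ∑-map f g []       = refl
  ∑-map f g (H ∷ Hs) = +-congˡ (∑-map f g Hs)

  ∑-+ : ∀ (f g : Graph v → Carrier) Hs → ∑[ Hs ] (λ H → f H + g H) ≈ ∑[ Hs ] f + ∑[ Hs ] g
  ∑-+ f g []       = sym (+-identityˡ 0#)
  ∑-+ f g (H ∷ Hs) = trans (+-congˡ (∑-+ f g Hs)) (interchange _ _ _ _)

  ∑-*ˡ : ∀ p (f : Graph v → Carrier) Hs → ∑[ Hs ] (λ H → p * f H) ≈ p * ∑[ Hs ] f
  ∑-*ˡ p f []       = sym (zeroʳ p)
  ∑-*ˡ p f (H ∷ Hs) = trans (+-congˡ (∑-*ˡ p f Hs)) (sym (distribˡ p _ _))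

  ∑-filter : ∀ {ℓ} {P : Pred (Graph v) ℓ} (P? : Decidable P) (f : Graph v → Carrier) Hs →
             ∑[ filter P? Hs ] f ≈ ∑[ Hs ] (λ H → f H when does (P? H))
  ∑-filter P? f []       = refl
  ∑-filter P? f (H ∷ Hs) with does (P? H)
  ... | true  = +-congˡ (∑-filter P? f Hs)
  ... | false = trans (∑-filter P? f Hs) (sym (+-identityˡ _))

  ∑-spanning-∷ : ∀ (f : Graph v → Carrier) e A →
    ∑[ spanningSubgraphs (e ∷ A) ] f ≈
    ∑[ spanningSubgraphs A ] (f ∘ (e ∷_)) + ∑[ spanningSubgraphs A ] f
  ∑-spanning-∷ f e A =
    trans (∑-++ f (map (e ∷_) (spanningSubgraphs A)) _) (+-congʳ (∑-map f (e ∷_) (spanningSubgraphs A)))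

  ∑-spanning-++ : ∀ (f : Graph v → Carrier) A B →
    ∑[ spanningSubgraphs (A ++ B) ] f ≈
    ∑[ spanningSubgraphs A ] (λ H → ∑[ spanningSubgraphs B ] (λ K → f (H ++ K)))
  ∑-spanning-++ f []      B = sym (+-identityʳ _)
  ∑-spanning-++ f (e ∷ A) B = begin
    ∑[ spanningSubgraphs (e ∷ A ++ B) ] f
      ≈⟨ ∑-spanning-∷ f e (A ++ B) ⟩
    ∑[ spanningSubgraphs (A ++ B) ] (f ∘ (e ∷_)) + ∑[ spanningSubgraphs (A ++ B) ] f
      ≈⟨ +-cong (∑-spanning-++ (f ∘ (e ∷_)) A B) (∑-spanning-++ f A B) ⟩
    _ ≈⟨ ∑-spanning-∷ _ e A ⟨
    ∑[ spanningSubgraphs (e ∷ A) ] (λ H → ∑[ spanningSubgraphs B ] (λ K → f (H ++ K))) ∎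

  ∑-spanning-map² : ∀ (f : Graph w → Carrier) (g : Fin v → Fin w) A →
    ∑[ spanningSubgraphs (map² g A) ] f ≈ ∑[ spanningSubgraphs A ] (f ∘ map² g)
  ∑-spanning-map² f g []      = refl
  ∑-spanning-map² f g (e ∷ A) = begin
    ∑[ spanningSubgraphs (map² g (e ∷ A)) ] f
      ≈⟨ ∑-spanning-∷ f _ (map² g A) ⟩
    _ ≈⟨ +-cong (∑-spanning-map² (f ∘ (_ ∷_)) g A) (∑-spanning-map² f g A) ⟩
    _ ≈⟨ ∑-spanning-∷ (f ∘ map² g) e A ⟨
    ∑[ spanningSubgraphs (e ∷ A) ] (f ∘ map² g) ∎

  ∑-subgraphs : Graph v → (Vec (Graph v) l → Carrier) → Carrier
  ∑-subgraphs {l = zero}  A F = F []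
  ∑-subgraphs {l = suc l} A F = ∑[ spanningSubgraphs A ] (λ H → ∑-subgraphs A (F ∘ (H ∷_)))

  ∑-subgraphs-cong : ∀ (A : Graph v) {F F′ : Vec (Graph v) l → Carrier} →
                     (∀ Hs → F Hs ≈ F′ Hs) → ∑-subgraphs A F ≈ ∑-subgraphs A F′
  ∑-subgraphs-cong {l = zero}  A F≈F′ = F≈F′ []
  ∑-subgraphs-cong {l = suc l} A F≈F′ =
    ∑-cong (spanningSubgraphs A) λ H → ∑-subgraphs-cong A (F≈F′ ∘ (H ∷_))

  -- A spanning subgraph of a union of edge lists is a choice in each part independently, so the sum
  -- becomes a nested sum over tuples of subgraphs of `A`.
  ∑-copies : ∀ m A is (f : Graph (order (suc m)) → Carrier) →
    ∑[ spanningSubgraphs (concatMap (λ i → copy m i A) is) ] f ≈ ∑-subgraphs A (f ∘ copies m is)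
  ∑-copies m A []       f = +-identityʳ _
  ∑-copies m A (i ∷ is) f = begin
    ∑[ spanningSubgraphs (copy m i A ++ As) ] f
      ≈⟨ ∑-spanning-++ f (copy m i A) As ⟩
    ∑[ spanningSubgraphs (copy m i A) ] (λ H → ∑[ spanningSubgraphs As ] (λ K → f (H ++ K)))
      ≈⟨ ∑-spanning-map² _ _ A ⟩
    ∑[ spanningSubgraphs A ] (λ H → ∑[ spanningSubgraphs As ] (λ K → f (copy m i H ++ K)))
      ≈⟨ ∑-cong (spanningSubgraphs A) (λ H → ∑-copies m A is (λ K → f (copy m i H ++ K))) ⟩
    ∑-subgraphs A (f ∘ copies m (i ∷ is)) ∎
    where As = concatMap (λ i → copy m i A) is

  ∑-patterns : (Vec Bool l → Carrier) → Carrier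
  ∑-patterns {zero}  g = g []
  ∑-patterns {suc l} g = ∑-patterns (g ∘ (true ∷_)) + ∑-patterns (g ∘ (false ∷_))

  ∑-patterns-cong : {g g′ : Vec Bool l → Carrier} → (∀ cs → g cs ≈ g′ cs) → ∑-patterns g ≈ ∑-patterns g′
  ∑-patterns-cong {zero}  e = e []
  ∑-patterns-cong {suc l} e = +-cong (∑-patterns-cong (e ∘ (true ∷_))) (∑-patterns-cong (e ∘ (false ∷_)))

  ∑-patterns-*ʳ : (g : Vec Bool l → Carrier) → ∀ p → ∑-patterns (λ cs → g cs * p) ≈ ∑-patterns g * p
  ∑-patterns-*ʳ {zero}  g p = refl
  ∑-patterns-*ʳ {suc l} g p = trans
    (+-cong (∑-patterns-*ʳ (g ∘ (true ∷_)) p) (∑-patterns-*ʳ (g ∘ (false ∷_)) p))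
    (sym (distribʳ p _ _))

  ∏ : Vec Carrier l → Carrier
  ∏ = Vec.foldr _ _*_ 1#

  module _ (A : Graph v) (s t : Fin v) where

    part : Bool → Carrier
    part true  = tutteConnected A s t
    part false = tutteDisconnected A s t

    -- A coefficient that depends only on connectivity is constant on each of the two classes of
    -- subgraphs and comes out of its partial sum.
    ∑-by-conn : ∀ (h : Bool → Carrier) → ∑[ spanningSubgraphs A ] (λ H → h (conn H s t) * term A H) ≈
                      h true * part true + h false * part false
    ∑-by-conn h = begin
      ∑[ Hs ] (λ H → h (conn H s t) * term A H)
        ≈⟨ ∑-cong Hs (λ H → cases (conn H s t) (term A H)) ⟩
      ∑[ Hs ] (λ H → h true * (term A H when conn H s t) + h false * (term A H when not (conn H s t)))
        ≈⟨ ∑-+ _ _ Hs ⟩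
      ∑[ Hs ] (λ H → h true * (term A H when conn H s t)) +
      ∑[ Hs ] (λ H → h false * (term A H when not (conn H s t)))
        ≈⟨ +-cong (∑-*ˡ (h true) _ Hs) (∑-*ˡ (h false) _ Hs) ⟩
      h true * ∑[ Hs ] (λ H → term A H when conn H s t) +
      h false * ∑[ Hs ] (λ H → term A H when not (conn H s t))
        ≈⟨ +-cong (*-congˡ (∑-filter (λ H → connected? H s t) (term A) Hs))
                  (*-congˡ (∑-filter (λ H → ¬? (connected? H s t)) (term A) Hs)) ⟨
      h true * part true + h false * part false ∎
      where
      Hs = spanningSubgraphs A
      cases : ∀ β p → h β * p ≈ h true * (p when β) + h false * (p when not β)
      cases true  p = sym (trans (+-congˡ (zeroʳ _)) (+-identityʳ _))
      cases false p = sym (trans (+-congʳ (zeroʳ _)) (+-identityˡ _))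

    tutte-split : tutte A ≈ tutteConnected A s t + tutteDisconnected A s t
    tutte-split = begin
      tutte A                          ≈⟨ ∑-cong (spanningSubgraphs A) (λ H → *-identityˡ (term A H)) ⟨
      _                                ≈⟨ ∑-by-conn (λ _ → 1#) ⟩
      1# * part true + 1# * part false ≈⟨ +-cong (*-identityˡ _) (*-identityˡ _) ⟩
      part true + part false           ∎

    -- With `H` fixed, the sum over the other subgraphs is by induction a function `h` of
    -- `conn H s t` alone times `term A H`, so `∑-by-conn` handles the outer sum.
    ∑-subgraphs-by-conn : ∀ (g : Vec Bool l → Carrier) →
      ∑-subgraphs A (λ Hs → g (Vec.map (λ H → conn H s t) Hs) * ∏ (Vec.map (term A) Hs)) ≈
      ∑-patterns (λ cs → g cs * ∏ (Vec.map part cs))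
    ∑-subgraphs-by-conn {zero}  g = refl
    ∑-subgraphs-by-conn {suc l} g = begin
      ∑[ spanningSubgraphs A ] (λ H → ∑-subgraphs A (λ Hs →
        g (conn H s t ∷ conns Hs) * (term A H * ∏ (Vec.map (term A) Hs))))
        ≈⟨ ∑-cong (spanningSubgraphs A) (λ H → begin
             ∑-subgraphs A (λ Hs → g (conn H s t ∷ conns Hs) * (term A H * ∏ (Vec.map (term A) Hs)))
               ≈⟨ ∑-subgraphs-cong {l = l} A (λ Hs → *-assoc _ _ _) ⟨
             ∑-subgraphs A (λ Hs → (g (conn H s t ∷ conns Hs) * term A H) * ∏ (Vec.map (term A) Hs))
               ≈⟨ ∑-subgraphs-by-conn (λ cs → g (conn H s t ∷ cs) * term A H) ⟩
             ∑-patterns (λ cs → (g (conn H s t ∷ cs) * term A H) * ∏ (Vec.map part cs))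
               ≈⟨ ∑-patterns-cong {l} (λ cs → xy∙z≈xz∙y _ _ _) ⟩
             ∑-patterns (λ cs → (g (conn H s t ∷ cs) * ∏ (Vec.map part cs)) * term A H)
               ≈⟨ ∑-patterns-*ʳ {l} _ (term A H) ⟩
             h (conn H s t) * term A H ∎) ⟩
      ∑[ spanningSubgraphs A ] (λ H → h (conn H s t) * term A H)
        ≈⟨ ∑-by-conn h ⟩
      h true * part true + h false * part false
        ≈⟨ +-cong (collect true) (collect false) ⟩
      ∑-patterns (λ cs → g cs * ∏ (Vec.map part cs)) ∎
      where
      open import Algebra.Properties.CommutativeSemigroup *-commutativeSemigroup using (xy∙z≈xz∙y; x∙yz≈xz∙y)
      conns : ∀ {l} → Vec (Graph v) l → Vec Bool l
      conns = Vec.map (λ H → conn H s t)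
      h : Bool → Carrier
      h β = ∑-patterns (λ cs → g (β ∷ cs) * ∏ (Vec.map part cs))
      collect : ∀ β → h β * part β ≈ ∑-patterns (λ cs → g (β ∷ cs) * ∏ (Vec.map part (β ∷ cs)))
      collect β = begin
        h β * part β
          ≈⟨ ∑-patterns-*ʳ {l} _ (part β) ⟨
        ∑-patterns (λ cs → (g (β ∷ cs) * ∏ (Vec.map part cs)) * part β)
          ≈⟨ ∑-patterns-cong {l} (λ cs → x∙yz≈xz∙y _ _ _) ⟨
        ∑-patterns (λ cs → g (β ∷ cs) * (part β * ∏ (Vec.map part cs))) ∎

-- The recursion where `x - 1` is invertible

module Recursion {c ℓ} (R : CommutativeRing c ℓ) (x y d : CommutativeRing.Carrier R)
  (ud≈1 : CommutativeRing._≈_ R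
    (CommutativeRing._*_ R (CommutativeRing._-_ R x (CommutativeRing.1# R)) d) (CommutativeRing.1# R)) where

  open CommutativeRing R
  open Tutte R x y
  open Sums R x y
  open import Algebra.Properties.Semiring.Exp semiring using (_^_; ^-homo-*; ^-congʳ)
  open import Algebra.Properties.CommutativeSemigroup *-commutativeSemigroup using (interchange)
  open import Relation.Binary.Reasoning.Setoid setoid

  u z : Carrier
  u = x - 1#
  z = y - 1#

  -- Taken with j the excess, so that `corank-framed` turns the exponent i + j into the sum of the
  -- coranks of the pieces.
  cancel-powers : ∀ i j → u ^ i ≈ d ^ j * u ^ (i ℕ.+ j)
  cancel-powers i j = begin
    u ^ i                      ≈⟨ *-identityʳ _ ⟨
    u ^ i * 1#                 ≈⟨ *-congˡ (ones j) ⟨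
    u ^ i * (u ^ j * d ^ j)    ≈⟨ *-assoc _ _ _ ⟨
    (u ^ i * u ^ j) * d ^ j    ≈⟨ *-congʳ (^-homo-* u i j) ⟨
    u ^ (i ℕ.+ j) * d ^ j      ≈⟨ *-comm _ _ ⟩
    d ^ j * u ^ (i ℕ.+ j)      ∎
    where
    ones : ∀ j → u ^ j * d ^ j ≈ 1#
    ones zero    = *-identityˡ 1#
    ones (suc j) = begin
      (u * u ^ j) * (d * d ^ j)  ≈⟨ interchange _ _ _ _ ⟩
      (u * d) * (u ^ j * d ^ j)  ≈⟨ *-cong ud≈1 (ones j) ⟩
      1# * 1#                    ≈⟨ *-identityˡ 1# ⟩
      1#                         ∎

  module _ (m : ℕ) where

    ∏-term : ∀ {l} (Hs : Vec (Graph (order m)) l) → ∏ (Vec.map (term (G m)) Hs) ≈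
      u ^ Vec.sum (Vec.map (corank {m}) Hs) * z ^ Vec.sum (Vec.map nullity Hs)
    ∏-term []       = sym (*-identityˡ 1#)
    ∏-term (H ∷ Hs) = begin
      (u ^ κ * z ^ n H) * ∏ (Vec.map (term (G m)) Hs)  ≈⟨ *-cong (*-congˡ (^-congʳ z (n≡nullity H))) (∏-term Hs) ⟩
      (u ^ κ * z ^ ν) * (u ^ κs * z ^ νs)              ≈⟨ interchange _ _ _ _ ⟩
      (u ^ κ * u ^ κs) * (z ^ ν * z ^ νs)              ≈⟨ *-cong (^-homo-* u κ κs) (^-homo-* z ν νs) ⟨
      u ^ (κ ℕ.+ κs) * z ^ (ν ℕ.+ νs)                  ∎
      where
      κ  = corank {m} H
      ν  = nullity H
      κs = Vec.sum (Vec.map (corank {m}) Hs)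
      νs = Vec.sum (Vec.map nullity Hs)

    weight : Bool → Vec Bool 4 → Carrier
    weight e cs = d ^ excess m e cs * z ^ nullity (frame m e cs)

    term-framed : ∀ e Hs → term (G (suc m)) (framed m e Hs) ≈
                           weight e (linkeds m Hs) * ∏ (Vec.map (term (G m)) Hs)
    term-framed e Hs = begin
      u ^ κ * z ^ n M
        ≈⟨ *-cong (cancel-powers κ j) (^-congʳ z (≡.trans (n≡nullity M) (nullity-framed m e Hs))) ⟩
      (d ^ j * u ^ (κ ℕ.+ j)) * z ^ (ν ℕ.+ νs)
        ≈⟨ *-cong (*-congˡ (^-congʳ u (corank-framed m e Hs))) (^-homo-* z ν νs) ⟩
      (d ^ j * u ^ κs) * (z ^ ν * z ^ νs)
        ≈⟨ interchange _ _ _ _ ⟩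
      (d ^ j * z ^ ν) * (u ^ κs * z ^ νs)
        ≈⟨ *-congˡ (∏-term Hs) ⟨
      weight e (linkeds m Hs) * ∏ (Vec.map (term (G m)) Hs) ∎
      where
      M  = framed m e Hs
      κ  = corank {suc m} M
      j  = excess m e (linkeds m Hs)
      κs = Vec.sum (Vec.map (corank {m}) Hs)
      ν  = nullity (frame m e (linkeds m Hs))
      νs = Vec.sum (Vec.map nullity Hs)

    -- `φ` is `id` for the partial sum over connected special vertices and `not` for the other one.
    contribution : (Bool → Bool) → Bool → Vec Bool 4 → Carrier
    contribution φ e cs = (weight e cs when φ (linked {suc m} (frame m e cs))) *
                          ∏ (Vec.map (part (G m) (X m) (Y m)) cs)

    ∑-framed : ∀ φ e →
      ∑-subgraphs (G m) (λ Hs → term (G (suc m)) (framed m e Hs) when φ (linked {suc m} (framed m e Hs)))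
      ≈ ∑-patterns (contribution φ e)
    ∑-framed φ e = begin
      _ ≈⟨ ∑-subgraphs-cong (G m) (λ Hs → begin
             term (G (suc m)) (framed m e Hs) when φ (linked {suc m} (framed m e Hs))
               ≡⟨ ≡.cong (λ c → term (G (suc m)) (framed m e Hs) when φ c) (linked-framed m e Hs) ⟩
             term (G (suc m)) (framed m e Hs) when φ (linked {suc m} (frame m e (linkeds m Hs)))
               ≈⟨ when-cong (φ (linked {suc m} (frame m e (linkeds m Hs)))) (term-framed e Hs) ⟩
             weight e (linkeds m Hs) * ∏ (Vec.map (term (G m)) Hs)
               when φ (linked {suc m} (frame m e (linkeds m Hs)))
               ≈⟨ when-* (φ (linked {suc m} (frame m e (linkeds m Hs)))) _ _ ⟨
             (weight e (linkeds m Hs) when φ (linked {suc m} (frame m e (linkeds m Hs)))) *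
               ∏ (Vec.map (term (G m)) Hs) ∎) ⟩
      _ ≈⟨ ∑-subgraphs-by-conn (G m) (X m) (Y m)
             (λ cs → weight e cs when φ (linked {suc m} (frame m e cs))) ⟩
      ∑-patterns (contribution φ e) ∎

    -- The edge ab heads the edge list of `G (suc m)`, so keeping or deleting it is the first split
    -- of the sum.
    ∑-when : ∀ φ →
      ∑[ spanningSubgraphs (G (suc m)) ] (λ H → term (G (suc m)) H when φ (linked {suc m} H)) ≈
      ∑-patterns (contribution φ true) + ∑-patterns (contribution φ false)
    ∑-when φ = begin
      ∑[ spanningSubgraphs (G (suc m)) ] f
        ≈⟨ ∑-spanning-∷ f (a m , b m) (concatMap (λ i → copy m i (G m)) (allFin 4)) ⟩
      _ ≈⟨ +-cong (∑-copies m (G m) (allFin 4) (f ∘ ((a m , b m) ∷_))) (∑-copies m (G m) (allFin 4) f) ⟩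
      _ ≈⟨ +-cong (∑-framed φ true) (∑-framed φ false) ⟩
      ∑-patterns (contribution φ true) + ∑-patterns (contribution φ false) ∎
      where
      f : Graph (order (suc m)) → Carrier
      f H = term (G (suc m)) H when φ (linked {suc m} H)

  open import Algebra.Solver.Ring.NaturalCoefficients.Default commutativeSemiring
    using (solve; _:=_; _:+_; _:*_; _:^_; _:×_; con; Polynomial)

  open import Algebra.Properties.Semiring.Mult semiring using (×-congʳ) renaming (_×_ to _·_)

  module _ (m : ℕ) where

    t₁ t₂ : Carrier
    t₁ = part (G m) (X m) (Y m) true
    t₂ = part (G m) (X m) (Y m) false

    -- The solver's expression for the sum over all frames: for concrete frames both
    -- it and the sum evaluate to the same 32 summands.
    module Reflected (D Z : Polynomial 4) (T : Bool → Polynomial 4) where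

      contributionᴾ : (Bool → Bool) → Bool → Vec Bool 4 → Polynomial 4
      contributionᴾ φ e cs =
        (if φ (linked {suc m} (frame m e cs)) then D :^ excess m e cs :* Z :^ nullity (frame m e cs) else con 0)
        :* Vec.foldr _ _:*_ (con 1) (Vec.map T cs)

      ∑ᴾ : ∀ {l} → (Vec Bool l → Polynomial 4) → Polynomial 4
      ∑ᴾ {zero}  g = g []
      ∑ᴾ {suc l} g = ∑ᴾ (g ∘ (true ∷_)) :+ ∑ᴾ (g ∘ (false ∷_))

      totalᴾ : (Bool → Bool) → Polynomial 4
      totalᴾ φ = ∑ᴾ (contributionᴾ φ true) :+ ∑ᴾ (contributionᴾ φ false)

    -- Four links give z² with ab and z without. Three links give z d or d, in 4 ways. Two links
    -- along a path X-a-Y or X-b-Y give d² or d; two opposite links, X-a with b-Y or X-b with a-Y,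
    -- join X to Y only with ab and give d².
    total-connected :
      ∑-patterns (contribution m id true) + ∑-patterns (contribution m id false) ≈
      (z + 1#) * z * t₁ ^ 4
      + 4 · (z + 1#) * d * t₁ ^ 3 * t₂
      + (2 · (d * d + d) + 2 · (d * d)) * t₁ ^ 2 * t₂ ^ 2
    total-connected = solve 4 (λ D Z T₁ T₂ → Reflected.totalᴾ D Z (λ β → if β then T₁ else T₂) id :=
      (Z :+ con 1) :* Z :* T₁ :^ 4
      :+ 4 :× (Z :+ con 1) :* D :* T₁ :^ 3 :* T₂
      :+ (2 :× (D :* D :+ D) :+ 2 :× (D :* D)) :* T₁ :^ 2 :* T₂ :^ 2) refl d z t₁ t₂

    -- Two links meeting at X or at Y give z d with ab, which closes a triangle, and d without; two
    -- opposite links without ab give d. One link, in 4 ways, or none gives d² with ab and d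
    -- without.
    total-disconnected :
      ∑-patterns (contribution m not true) + ∑-patterns (contribution m not false) ≈
      (2 · (z + 1#) + 2 · 1#) * d * t₁ ^ 2 * t₂ ^ 2
      + 4 · (d * d + d) * t₁ * t₂ ^ 3
      + (d * d + d) * t₂ ^ 4
    total-disconnected = solve 4 (λ D Z T₁ T₂ → Reflected.totalᴾ D Z (λ β → if β then T₁ else T₂) not :=
      (2 :× (Z :+ con 1) :+ 2 :× con 1) :* D :* T₁ :^ 2 :* T₂ :^ 2
      :+ 4 :× (D :* D :+ D) :* T₁ :* T₂ :^ 3
      :+ (D :* D :+ D) :* T₂ :^ 4) refl d z t₁ t₂

  p-1+1 : ∀ p → (p - 1#) + 1# ≈ p
  p-1+1 p = trans (+-assoc p (- 1#) 1#) (trans (+-congˡ (-‿inverseˡ 1#)) (+-identityʳ p))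

  -- This combines the weights d² with ab and d without it into the coefficient x/(x-1)², using x =
  -- u + 1 and u d = 1.
  x*d² : x * (d * d) ≈ d * d + d
  x*d² = begin
    x * (d * d)               ≈⟨ *-congʳ (p-1+1 x) ⟨
    (u + 1#) * (d * d)        ≈⟨ solve 2 (λ u d → (u :+ con 1) :* (d :* d) := d :* d :+ u :* d :* d) refl u d ⟩
    d * d + u * d * d         ≈⟨ +-congˡ (trans (*-congʳ ud≈1) (*-identityˡ d)) ⟩
    d * d + d                 ∎

  module _ (m : ℕ) where

    connected-recursion : tutteConnected (G (suc m)) (X (suc m)) (Y (suc m)) ≈
      y * (y - 1#) * t₁ m ^ 4
      + 4 · y * d * t₁ m ^ 3 * t₂ m
      + (2 · x + 2 · 1#) * (d * d) * t₁ m ^ 2 * t₂ m ^ 2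
    connected-recursion = begin
      tutteConnected (G (suc m)) (X (suc m)) (Y (suc m))
        ≈⟨ ∑-filter (λ H → connected? H (X (suc m)) (Y (suc m))) _ (spanningSubgraphs (G (suc m))) ⟩
      _ ≈⟨ ∑-when m id ⟩
      _ ≈⟨ total-connected m ⟩
      _ ≈⟨ +-cong (+-cong (*-congʳ (*-congʳ (p-1+1 y)))
                          (*-congʳ (*-congʳ (*-congʳ (×-congʳ 4 (p-1+1 y))))))
                  (*-congʳ (*-congʳ (trans (+-congʳ (×-congʳ 2 (sym x*d²)))
                    (solve 2 (λ x e → 2 :× (x :* e) :+ 2 :× e := (2 :× x :+ 2 :× con 1) :* e)
                      refl x (d * d))))) ⟩
      _ ∎

    disconnected-recursion : tutteDisconnected (G (suc m)) (X (suc m)) (Y (suc m)) ≈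
      (2 · y + 2 · 1#) * d * t₁ m ^ 2 * t₂ m ^ 2
      + 4 · x * (d * d) * t₁ m * t₂ m ^ 3
      + x * (d * d) * t₂ m ^ 4
    disconnected-recursion = begin
      tutteDisconnected (G (suc m)) (X (suc m)) (Y (suc m))
        ≈⟨ ∑-filter (λ H → ¬? (connected? H (X (suc m)) (Y (suc m)))) _ (spanningSubgraphs (G (suc m))) ⟩
      _ ≈⟨ ∑-when m not ⟩
      _ ≈⟨ total-disconnected m ⟩
      _ ≈⟨ +-cong (+-cong (*-congʳ (*-congʳ (*-congʳ (+-congʳ (×-congʳ 2 (p-1+1 y))))))
                          (*-congʳ (*-congʳ (trans (×-congʳ 4 (sym x*d²))
                            (solve 2 (λ x e → 4 :× (x :* e) := 4 :× x :* e) refl x (d * d))))))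
                  (*-congʳ (sym x*d²)) ⟩
      _ ∎

-- Passage from polynomials to fractions

module Transport {c₁ ℓ₁ c₂ ℓ₂} (R : CommutativeRing c₁ ℓ₁) (S : CommutativeRing c₂ ℓ₂) where

  private
    module R = CommutativeRing R
    module S = CommutativeRing S

  module Along {φ : R.Carrier → S.Carrier} (φ-hom : RingMorphisms.IsRingHomomorphism R.rawRing S.rawRing φ)
    (x y : R.Carrier) where

    open RingMorphisms.IsRingHomomorphism φ-hom using (+-homo; *-homo; 0#-homo; 1#-homo; -‿homo)
    open S using (_≈_; setoid)
    open import Relation.Binary.Reasoning.Setoid setoid
    open import Algebra.Properties.Semiring.Exp R.semiring using () renaming (_^_ to _^ᴿ_)
    open import Algebra.Properties.Semiring.Exp S.semiring using (^-congˡ) renaming (_^_ to _^ˢ_)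
    open import Algebra.Properties.Semiring.Mult R.semiring using () renaming (_×_ to _·ᴿ_)
    open import Algebra.Properties.Semiring.Mult S.semiring using () renaming (_×_ to _·ˢ_)

    private
      module TR = Tutte R x y
      module TS = Tutte S (φ x) (φ y)

    ^-homo : ∀ p i → φ (p ^ᴿ i) ≈ φ p ^ˢ i
    ^-homo p zero    = 1#-homo
    ^-homo p (suc i) = S.trans (*-homo p (p ^ᴿ i)) (S.*-congˡ (^-homo p i))

    ·-homo : ∀ i p → φ (i ·ᴿ p) ≈ i ·ˢ φ p
    ·-homo zero    p = 0#-homo
    ·-homo (suc i) p = S.trans (+-homo p (i ·ᴿ p)) (S.+-congˡ (·-homo i p))

    [-1]-homo : ∀ p → φ (p R.- R.1#) ≈ φ p S.- S.1#
    [-1]-homo p = S.trans (+-homo p _) (S.+-congˡ (S.trans (-‿homo R.1#) (S.-‿cong 1#-homo)))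

    term-homo : ∀ (A H : Graph v) → φ (TR.term A H) ≈ TS.term A H
    term-homo A H = S.trans (*-homo _ _) (S.*-cong (power x (r A ∸ r H)) (power y (n H)))
      where
      power : ∀ p i → φ ((p R.- R.1#) ^ᴿ i) ≈ (φ p S.- S.1#) ^ˢ i
      power p i = S.trans (^-homo _ i) (^-congˡ i ([-1]-homo p))

    ∑-term-homo : ∀ (A : Graph v) Hs → φ (TR.∑[ Hs ] TR.term A) ≈ TS.∑[ Hs ] TS.term A
    ∑-term-homo A []       = 0#-homo
    ∑-term-homo A (H ∷ Hs) = S.trans (+-homo _ _) (S.+-cong (term-homo A H) (∑-term-homo A Hs))

module FractionProperties {c ℓ} (R : CommutativeRing c ℓ) (dom : IsDiscreteDomain R) where

  open CommutativeRing R
  open Fractions R dom hiding (commutativeRing)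
  open import Algebra.Solver.Ring.NaturalCoefficients.Default commutativeSemiring
    using (solve; _:=_; _:+_; _:*_; con)

  private
    module K = CommutativeRing (Fractions.commutativeRing R dom)

  ι-isRingHomomorphism : RingMorphisms.IsRingHomomorphism rawRing K.rawRing ι
  ι-isRingHomomorphism = record
    { isSemiringHomomorphism = record
      { isNearSemiringHomomorphism = record
        { +-isMonoidHomomorphism = record
          { isMagmaHomomorphism = record
            { isRelHomomorphism = record { cong = λ p≈q → cross (*-congʳ p≈q) }
            ; homo = λ p q → cross (solve 2 (λ p q →
                (p :+ q) :* (con 1 :* con 1) := (p :* con 1 :+ q :* con 1) :* con 1) refl p q)
            }
          ; ε-homo = K.refl
          }
        ; *-homo = λ p q → cross (solve 2 (λ p q →
            (p :* q) :* (con 1 :* con 1) := (p :* q) :* con 1) refl p q)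
        }
      ; 1#-homo = K.refl
      }
    ; -‿homo = λ p → K.refl
    }

  open import Algebra.Properties.Semiring.Exp semiring using (_^_)

  module _ {q : Carrier} (q≉0 : q ≉ 0#) where

    recip : Fraction
    recip = fraction 1# q q≉0

    ι*recip : ι q K.* recip K.≈ K.1#
    ι*recip = cross (solve 1 (λ q → (q :* con 1) :* con 1 := con 1 :* (con 1 :* q)) refl q)

    -- Any proof that the denominator is nonzero is accepted, so the lemma also fits the proof built
    -- into `_/[x-1]^_`.
    /^1 : ∀ p (q¹≉0 : q ^ 1 ≉ 0#) → fraction p (q ^ 1) q¹≉0 K.≈ ι p K.* recip
    /^1 p _ = cross (solve 2 (λ p q → p :* (con 1 :* q) := (p :* con 1) :* (q :* con 1)) refl p q)

    /^2 : ∀ p (q²≉0 : q ^ 2 ≉ 0#) → fraction p (q ^ 2) q²≉0 K.≈ ι p K.* (recip K.* recip)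
    /^2 p _ = cross (solve 2 (λ p q →
      p :* (con 1 :* (q :* q)) := (p :* (con 1 :* con 1)) :* (q :* (q :* con 1))) refl p q)

module Initial {c ℓ} (R : CommutativeRing c ℓ) (x y : CommutativeRing.Carrier R) where

  open CommutativeRing R
  open Tutte R x y

  connected-initial : tutteConnected (G 0) (X 0) (Y 0) ≈ 1#
  connected-initial = trans (+-identityʳ _) (*-identityˡ _)

  disconnected-initial : tutteDisconnected (G 0) (X 0) (Y 0) ≈ x - 1#
  disconnected-initial = trans (+-identityʳ _) (trans (*-identityʳ _) (*-identityʳ _))

module FractionRecursion {c ℓ} (R : CommutativeRing c ℓ) (dom : IsDiscreteDomain R)
  (x y : CommutativeRing.Carrier R) where

  open CommutativeRing R

  module _ (x-1≉0 : x - 1# ≉ 0#) where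

    open Fractions R dom using (Fraction; fraction; ι)
    open FractionProperties R dom
    open Transport.Along R (Fractions.commutativeRing R dom) ι-isRingHomomorphism x y
    open Tutte R x y
    open RingMorphisms.IsRingHomomorphism ι-isRingHomomorphism using (+-homo; *-homo)
    open import Algebra.Properties.Semiring.Exp semiring using (_^_)
    open import Algebra.Properties.Semiring.Mult semiring using () renaming (_×_ to _·_)

    private
      module K = CommutativeRing (Fractions.commutativeRing R dom)
      open K using () renaming (_≈_ to _≈ᶠ_; _+_ to _+ᶠ_; _*_ to _*ᶠ_)
      open import Algebra.Properties.Semiring.Exp K.semiring using (^-congˡ) renaming (_^_ to _^ᶠ_)
      open import Algebra.Properties.Semiring.Mult K.semiring using () renaming (_×_ to _·ᶠ_)
      open import Relation.Binary.Reasoning.Setoid K.setoid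
      module Tᶠ = Tutte (Fractions.commutativeRing R dom) (ι x) (ι y)

      d : Fraction
      d = recip x-1≉0

      ud≈1 : (ι x K.- K.1#) *ᶠ d ≈ᶠ K.1#
      ud≈1 = K.trans (K.*-congʳ {d} (K.sym ([-1]-homo x))) (ι*recip x-1≉0)

      module E = Recursion (Fractions.commutativeRing R dom) (ι x) (ι y) d ud≈1

      2·p+2·1-homo : ∀ p → ι (2 · p + 2 · 1#) ≈ᶠ 2 ·ᶠ ι p +ᶠ 2 ·ᶠ K.1#
      2·p+2·1-homo p = K.trans (+-homo (2 · p) (2 · 1#)) (K.+-cong (·-homo 2 p) (·-homo 2 1#))

      -- `E.t₁` is the partial sum formed among fractions at `ι x` and `ι y`, whereas the recursion
      -- to be shown speaks of the image of the polynomial. The filtered list of subgraphs is the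
      -- same in both rings, so only the terms need comparison.
      connected-homo : ∀ m → ι (tutteConnected (G m) (X m) (Y m)) ≈ᶠ E.t₁ m
      connected-homo m =
        ∑-term-homo (G m) (filter (λ H → connected? H (X m) (Y m)) (spanningSubgraphs (G m)))

      disconnected-homo : ∀ m → ι (tutteDisconnected (G m) (X m) (Y m)) ≈ᶠ E.t₂ m
      disconnected-homo m =
        ∑-term-homo (G m) (filter (λ H → ¬? (connected? H (X m) (Y m))) (spanningSubgraphs (G m)))

    module _ (¹≉0 : (x - 1#) ^ 1 ≉ 0#) (²≉0 : (x - 1#) ^ 2 ≉ 0#) (m : ℕ) where

      private
        s₁ s₂ : Fraction
        s₁ = ι (tutteConnected (G m) (X m) (Y m))
        s₂ = ι (tutteDisconnected (G m) (X m) (Y m))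

        ^₁ : ∀ i → E.t₁ m ^ᶠ i ≈ᶠ s₁ ^ᶠ i
        ^₁ i = ^-congˡ i (K.sym (connected-homo m))

        ^₂ : ∀ i → E.t₂ m ^ᶠ i ≈ᶠ s₂ ^ᶠ i
        ^₂ i = ^-congˡ i (K.sym (disconnected-homo m))

        over¹ : ∀ {p q} → ι p ≈ᶠ q → q *ᶠ d ≈ᶠ fraction p ((x - 1#) ^ 1) ¹≉0
        over¹ {p} e = K.trans (K.*-congʳ {d} (K.sym e)) (K.sym (/^1 x-1≉0 p ¹≉0))

        over² : ∀ {p q} → ι p ≈ᶠ q → q *ᶠ (d *ᶠ d) ≈ᶠ fraction p ((x - 1#) ^ 2) ²≉0
        over² {p} e = K.trans (K.*-congʳ {d *ᶠ d} (K.sym e)) (K.sym (/^2 x-1≉0 p ²≉0))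

      connected-fraction-recursion : ι (tutteConnected (G (suc m)) (X (suc m)) (Y (suc m))) ≈ᶠ
        ι (y * (y - 1#)) *ᶠ s₁ ^ᶠ 4
        +ᶠ fraction (4 · y) ((x - 1#) ^ 1) ¹≉0 *ᶠ s₁ ^ᶠ 3 *ᶠ s₂
        +ᶠ fraction (2 · x + 2 · 1#) ((x - 1#) ^ 2) ²≉0 *ᶠ s₁ ^ᶠ 2 *ᶠ s₂ ^ᶠ 2
      connected-fraction-recursion = begin
        ι (tutteConnected (G (suc m)) (X (suc m)) (Y (suc m)))
          ≈⟨ connected-homo (suc m) ⟩
        Tᶠ.tutteConnected (G (suc m)) (X (suc m)) (Y (suc m))
          ≈⟨ E.connected-recursion m ⟩
        _ ≈⟨ K.+-cong (K.+-cong
               (K.*-cong (K.sym (K.trans (*-homo y (y - 1#)) (K.*-congˡ {ι y} ([-1]-homo y)))) (^₁ 4))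
               (K.*-cong (K.*-cong (over¹ (·-homo 4 y)) (^₁ 3)) (K.sym (disconnected-homo m))))
               (K.*-cong (K.*-cong (over² (2·p+2·1-homo x)) (^₁ 2)) (^₂ 2)) ⟩
        _ ∎

      disconnected-fraction-recursion : ι (tutteDisconnected (G (suc m)) (X (suc m)) (Y (suc m))) ≈ᶠ
        fraction (2 · y + 2 · 1#) ((x - 1#) ^ 1) ¹≉0 *ᶠ s₁ ^ᶠ 2 *ᶠ s₂ ^ᶠ 2
        +ᶠ fraction (4 · x) ((x - 1#) ^ 2) ²≉0 *ᶠ s₁ *ᶠ s₂ ^ᶠ 3
        +ᶠ fraction x ((x - 1#) ^ 2) ²≉0 *ᶠ s₂ ^ᶠ 4
      disconnected-fraction-recursion = begin
        ι (tutteDisconnected (G (suc m)) (X (suc m)) (Y (suc m)))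
          ≈⟨ disconnected-homo (suc m) ⟩
        Tᶠ.tutteDisconnected (G (suc m)) (X (suc m)) (Y (suc m))
          ≈⟨ E.disconnected-recursion m ⟩
        _ ≈⟨ K.+-cong (K.+-cong
               (K.*-cong (K.*-cong (over¹ (2·p+2·1-homo y)) (^₁ 2)) (^₂ 2))
               (K.*-cong (K.*-cong (over² (·-homo 4 x)) (K.sym (connected-homo m))) (^₂ 3)))
               (K.*-cong (over² K.refl) (^₂ 4)) ⟩
        _ ∎

-- Specialisation to ℤ[x,y]

open Defs using (x; y; _≈_; _≉_; _+_; _-_; _*_; 0#; 1#; _·_; ι; _≈ᶠ_; _+ᶠ_; _*ᶠ_; _^ᶠ_)

theorem1 :
    (∀ m →
      let t₁ = ι (T₁ m)
          t₂ = ι (T₂ m)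
      in
      (T (suc m) ≈ T₁ (suc m) + T₂ (suc m)) ×
      (ι (T₁ (suc m)) ≈ᶠ
        ι (y * (y - 1#)) *ᶠ t₁ ^ᶠ 4
        +ᶠ ((4 · y) /[x-1]^ 1) *ᶠ t₁ ^ᶠ 3 *ᶠ t₂
        +ᶠ ((2 · x + 2 · 1#) /[x-1]^ 2) *ᶠ t₁ ^ᶠ 2 *ᶠ t₂ ^ᶠ 2) ×
      (ι (T₂ (suc m)) ≈ᶠ
        ((2 · y + 2 · 1#) /[x-1]^ 1) *ᶠ t₁ ^ᶠ 2 *ᶠ t₂ ^ᶠ 2
        +ᶠ ((4 · x) /[x-1]^ 2) *ᶠ t₁ *ᶠ t₂ ^ᶠ 3
        +ᶠ (x /[x-1]^ 2) *ᶠ t₂ ^ᶠ 4)) ×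
    (T₁ 0 ≈ 1#) ×
    (T₂ 0 ≈ x - 1#)
theorem1 =
  (λ m → Sums.tutte-split ℤ[x,y] x y (G (suc m)) (X (suc m)) (Y (suc m))
       , connected-fraction-recursion x-1≉0 [x-1]^ 1 ≉0 [x-1]^ 2 ≉0 m
       , disconnected-fraction-recursion x-1≉0 [x-1]^ 1 ≉0 [x-1]^ 2 ≉0 m)
  , Initial.connected-initial ℤ[x,y] x y
  , Initial.disconnected-initial ℤ[x,y] x y
  where
  x-1≉0 : x - 1# ≉ 0#
  -- Comparing constant coefficients would give -1 = 0 in ℤ.
  x-1≉0 e with () ← e .ℤ[x][y].at 0 .ℤ[x].at 0
  open FractionRecursion ℤ[x,y] ℤ[x,y]-isDiscreteDomain x y
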